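{- Let $G=C_2^3\times C_3$ with generators $u,v,w,z$ of orders $2,2,2,3$. For an odd integer $D$, $D\in S(G)$ if and only if $D\equiv1\pmod8$ and $\mathsf T(D)$ holds. Every such determinant is the determinant of an element of $\mathbb Z[G]$ of the form $$1+(1+u)(1+v)(1+w)(r+sz+tz^2),\qquad r,s,t\in\mathbb Z.$$
   Context: For a finite group $G$, the determinant of $\sum a_gg\in\mathbb Z[G]$ is $\det(a_{gh^{ -1}})_{g,h\in G}$, and $S(G)$ is the set of all such determinants. The group $C_2^3\times C_3$ is isomorphic to $C_2\times C_2\times C_6$. $O=\mathbb Z[\omega]$ with $\omega^2+\omega+1=0$, $\lambda=1-\omega$, $N(b+c\omega)=b^2-bc+c^2$. For a nonzero signed odd integer $t$, $\mathsf T(t)$ is the condition that there exist an odd $A\in\mathbb Z$ and $\beta\in O$ with $t=A\,N(\beta)$, $\beta\equiv1\pmod{8O}$ and $A\equiv\beta\pmod{\lambda O}$. -}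

module Defs where

open import Algebra.Bundles using (CommutativeRing; Semiring)
open import Algebra.Structures using (IsGroup)
import Algebra.Definitions.RawMonoid as RawMonoidOps
import Algebra.Definitions.RawSemiring as RawSemiringOps
open import Data.Bool.Base using (if_then_else_)
open import Data.Fin.Base as Fin using (Fin; zero; suc; toℕ; punchIn)
open import Data.Fin.Properties using (toℕ-injective; toℕ-fromℕ<; toℕ<n; *↔×)
import Data.Fin.Properties as Fin
open import Data.Integer.Base as ℤ using (ℤ; +_; 0ℤ; 1ℤ)
import Data.Integer.Divisibility.Signed as ℤ
import Data.Integer.Properties as ℤ
open import Data.Nat.Base as ℕ using (ℕ; zero; suc; NonZero; _%_)
open import Data.Nat.DivMod as ℕ using (_mod_)
import Data.Nat.Properties as ℕ
open import Data.Product.Base using (∃-syntax; _×_; _,_; map)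
open import Data.Product.Function.NonDependent.Propositional using (_×-↔_)
open import Function.Bundles using (_↔_; Inverse)
open import Function.Construct.Composition using (_↔-∘_)
open import Function.Construct.Identity using (↔-id)
open import Function.Construct.Symmetry using (↔-sym)
open import Function.Properties.Inverse using (Inverse⇒Injection)
open import Relation.Binary.Definitions using (DecidableEquality)
open import Relation.Binary.PropositionalEquality
  using (_≡_; refl; sym; trans; cong; cong₂; isEquivalence; module ≡-Reasoning)
open import Relation.Nullary.Decidable.Core using (does)
open import Relation.Nullary.Decidable using (via-injection)
open import Relation.Nullary.Negation.Core using (¬_)

module Determinant {c ℓ} (R : CommutativeRing c ℓ) where
  open CommutativeRing R hiding (zero)
  open RawMonoidOps +-rawMonoid using (sum)
  open RawSemiringOps (Semiring.rawSemiring semiring) using (_^_)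

  -- Laplace expansion along the first row; M i j is the entry in row i
  -- and column j.
  det : ∀ n → (Fin n → Fin n → Carrier) → Carrier
  det zero    M = 1#
  det (suc n) M = sum λ j →
    (- 1#) ^ toℕ j * M zero j * det n (λ i k → M (suc i) (punchIn j k))

open Determinant ℤ.+-*-commutativeRing public

record FiniteGroup : Set₁ where
  infixl 7 _∙_
  infix  8 _⁻¹
  field
    Carrier     : Set
    _∙_         : Carrier → Carrier → Carrier
    ε           : Carrier
    _⁻¹         : Carrier → Carrier
    isGroup     : IsGroup _≡_ _∙_ ε _⁻¹
    order       : ℕ
    enumeration : Fin order ↔ Carrier

  element : Fin order → Carrier
  element = Inverse.to enumeration

  _≟_ : DecidableEquality Carrier
  _≟_ = via-injection (Inverse⇒Injection (↔-sym enumeration)) Fin._≟_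

infixr 2 _×ᴳ_

_×ᴳ_ : FiniteGroup → FiniteGroup → FiniteGroup
G ×ᴳ H = record
  { Carrier = G.Carrier × H.Carrier
  ; _∙_     = λ (g , h) (g′ , h′) → g G.∙ g′ , h H.∙ h′
  ; ε       = G.ε , H.ε
  ; _⁻¹     = map G._⁻¹ H._⁻¹
  ; isGroup = record
    { isMonoid = record
      { isSemigroup = record
        { isMagma = record
          { isEquivalence = isEquivalence
          ; ∙-cong        = cong₂ _
          }
        ; assoc = λ (a , x) (b , y) (c , z) →
            cong₂ _,_ (GG.assoc a b c) (HG.assoc x y z)
        }
      ; identity = (λ (a , x) → cong₂ _,_ (GG.identityˡ a) (HG.identityˡ x))
                 , (λ (a , x) → cong₂ _,_ (GG.identityʳ a) (HG.identityʳ x))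
      }
    ; inverse = (λ (a , x) → cong₂ _,_ (GG.inverseˡ a) (HG.inverseˡ x))
              , (λ (a , x) → cong₂ _,_ (GG.inverseʳ a) (HG.inverseʳ x))
    ; ⁻¹-cong = cong (map G._⁻¹ H._⁻¹)
    }
  ; order       = G.order ℕ.* H.order
  ; enumeration = (G.enumeration ×-↔ H.enumeration) ↔-∘ *↔×
  }
  where
  module G = FiniteGroup G
  module H = FiniteGroup H
  module GG = IsGroup G.isGroup
  module HG = IsGroup H.isGroup

module _ (n : ℕ) .{{_ : NonZero n}} where

  private
    _⊕_ : Fin n → Fin n → Fin n
    i ⊕ j = (toℕ i ℕ.+ toℕ j) mod n

    ⊖_ : Fin n → Fin n
    ⊖ i = (n ℕ.∸ toℕ i) mod n

    0′ : Fin n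
    0′ = 0 mod n

    toℕ-mod : ∀ k → toℕ (k mod n) ≡ k % n
    toℕ-mod k = toℕ-fromℕ< _

    mod-toℕ : ∀ i → toℕ i mod n ≡ i
    mod-toℕ i = toℕ-injective (trans (toℕ-mod _) (ℕ.m<n⇒m%n≡m (toℕ<n i)))

    %⇒mod : ∀ {k l} → k % n ≡ l % n → k mod n ≡ l mod n
    %⇒mod {k} {l} e = toℕ-injective (trans (toℕ-mod k) (trans e (sym (toℕ-mod l))))

    +-%ˡ : ∀ k l → (k % n ℕ.+ l) % n ≡ (k ℕ.+ l) % n
    +-%ˡ k l = begin
      (k % n ℕ.+ l) % n           ≡⟨ ℕ.%-distribˡ-+ (k % n) l n ⟩
      (k % n % n ℕ.+ l % n) % n   ≡⟨ cong (λ x → (x ℕ.+ l % n) % n) (ℕ.m%n%n≡m%n k n) ⟩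
      (k % n ℕ.+ l % n) % n       ≡⟨ ℕ.%-distribˡ-+ k l n ⟨
      (k ℕ.+ l) % n               ∎
      where open ≡-Reasoning

    ⊕-comm : ∀ i j → i ⊕ j ≡ j ⊕ i
    ⊕-comm i j = cong (_mod n) (ℕ.+-comm (toℕ i) (toℕ j))

    mod-⊕ : ∀ k j → (k mod n) ⊕ j ≡ (k ℕ.+ toℕ j) mod n
    mod-⊕ k j = trans (cong (λ x → (x ℕ.+ toℕ j) mod n) (toℕ-mod k))
                      (%⇒mod (+-%ˡ k (toℕ j)))

    ⊕-assoc : ∀ i j k → (i ⊕ j) ⊕ k ≡ i ⊕ (j ⊕ k)
    ⊕-assoc i j k = begin
      (i ⊕ j) ⊕ k                              ≡⟨ mod-⊕ (a ℕ.+ b) k ⟩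
      ((a ℕ.+ b) ℕ.+ c) mod n                  ≡⟨ cong (_mod n) (ℕ.+-assoc a b c) ⟩
      (a ℕ.+ (b ℕ.+ c)) mod n                  ≡⟨ cong (_mod n) (ℕ.+-comm a (b ℕ.+ c)) ⟩
      ((b ℕ.+ c) ℕ.+ a) mod n                  ≡⟨ mod-⊕ (b ℕ.+ c) i ⟨
      (j ⊕ k) ⊕ i                              ≡⟨ ⊕-comm (j ⊕ k) i ⟩
      i ⊕ (j ⊕ k)                              ∎
      where
      open ≡-Reasoning
      a b c : ℕ
      a = toℕ i
      b = toℕ j
      c = toℕ k

    ⊕-identityˡ : ∀ i → 0′ ⊕ i ≡ i
    ⊕-identityˡ i = trans (mod-⊕ 0 i) (mod-toℕ i)

    ⊕-inverseˡ : ∀ i → (⊖ i) ⊕ i ≡ 0′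
    ⊕-inverseˡ i = begin
      (⊖ i) ⊕ i                         ≡⟨ mod-⊕ (n ℕ.∸ toℕ i) i ⟩
      (n ℕ.∸ toℕ i ℕ.+ toℕ i) mod n     ≡⟨ cong (_mod n) (ℕ.m∸n+n≡m (ℕ.<⇒≤ (toℕ<n i))) ⟩
      n mod n                           ≡⟨ %⇒mod (trans (ℕ.n%n≡0 n) (sym (ℕ.m*n%n≡0 0 n))) ⟩
      0′                                ∎
      where open ≡-Reasoning

  cyclic : FiniteGroup
  cyclic = record
    { Carrier = Fin n
    ; _∙_     = _⊕_
    ; ε       = 0′
    ; _⁻¹     = ⊖_
    ; isGroup = record
      { isMonoid = record
        { isSemigroup = record
          { isMagma = record
            { isEquivalence = isEquivalence
            ; ∙-cong        = cong₂ _
            }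
          ; assoc = ⊕-assoc
          }
        ; identity = ⊕-identityˡ , λ i → trans (⊕-comm i 0′) (⊕-identityˡ i)
        }
      ; inverse = ⊕-inverseˡ , λ i → trans (⊕-comm i (⊖ i)) (⊕-inverseˡ i)
      ; ⁻¹-cong = cong ⊖_
      }
    ; order       = n
    ; enumeration = ↔-id (Fin n)
    }

module GroupRing (G : FiniteGroup) where
  open FiniteGroup G
  open RawMonoidOps ℤ.+-0-rawMonoid using (sum)

  -- The element Σ a_g g is represented by the coefficient function g ↦ a_g.
  ℤ[G] : Set
  ℤ[G] = Carrier → ℤ

  infixl 6 _+_
  infixl 7 _*_
  infixr 8 _·_

  ⟦_⟧ : Carrier → ℤ[G]
  ⟦ g ⟧ h = if does (g ≟ h) then 1ℤ else 0ℤ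

  1# : ℤ[G]
  1# = ⟦ ε ⟧

  _+_ : ℤ[G] → ℤ[G] → ℤ[G]
  (a + b) g = a g ℤ.+ b g

  _*_ : ℤ[G] → ℤ[G] → ℤ[G]
  (a * b) g = sum λ i → a (element i) ℤ.* b (element i ⁻¹ ∙ g)

  _·_ : ℤ → ℤ[G] → ℤ[G]
  (k · a) g = k ℤ.* a g

  -- det (a_{gh⁻¹})_{g,h∈G}; rows and columns are listed in the same order,
  -- so the value does not depend on the enumeration.
  determinant : ℤ[G] → ℤ
  determinant a = det order λ i j → a (element i ∙ element j ⁻¹)

infix 4 _∈S_

_∈S_ : ℤ → FiniteGroup → Set
D ∈S G = ∃[ a ] determinant a ≡ D
  where open GroupRing G

C₂³×C₃ : FiniteGroup
C₂³×C₃ = cyclic 2 ×ᴳ cyclic 2 ×ᴳ cyclic 2 ×ᴳ cyclic 3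

module Generators where
  open FiniteGroup C₂³×C₃ using (Carrier)

  u v w z : Carrier
  u = suc zero , zero     , zero     , zero
  v = zero     , suc zero , zero     , zero
  w = zero     , zero     , suc zero , zero
  z = zero     , zero     , zero     , suc zero

specialElement : ℤ → ℤ → ℤ → GroupRing.ℤ[G] C₂³×C₃
specialElement r s t =
  1# + (1# + ⟦ u ⟧) * (1# + ⟦ v ⟧) * (1# + ⟦ w ⟧)
     * (r · 1# + s · ⟦ z ⟧ + t · (⟦ z ⟧ * ⟦ z ⟧))
  where
  open GroupRing C₂³×C₃
  open Generators

infix 5 _+ω_

-- ℤ[ω] with ω² + ω + 1 = 0; b +ω c stands for b + cω.
record O : Set where
  constructor _+ω_
  field
    coeff₁ coeffω : ℤ

ι : ℤ → O
ι k = k +ω 0ℤ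

infixl 6 _-ᴼ_
infixl 7 _*ᴼ_

_-ᴼ_ : O → O → O
(a +ω b) -ᴼ (c +ω d) = (a ℤ.- c) +ω (b ℤ.- d)

-- Uses ω² = -1 - ω.
_*ᴼ_ : O → O → O
(a +ω b) *ᴼ (c +ω d) =
  (a ℤ.* c ℤ.- b ℤ.* d) +ω (a ℤ.* d ℤ.+ b ℤ.* c ℤ.- b ℤ.* d)

ω λᴼ : O
ω  = 0ℤ +ω 1ℤ
λᴼ = ι 1ℤ -ᴼ ω

N : O → ℤ
N (b +ω c) = b ℤ.* b ℤ.- b ℤ.* c ℤ.+ c ℤ.* c

infix 4 _≡ᴼ_[mod_]

_≡ᴼ_[mod_] : O → O → O → Set
x ≡ᴼ y [mod m ] = ∃[ γ ] x -ᴼ y ≡ m *ᴼ γ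

Odd : ℤ → Set
Odd k = ¬ (+ 2 ℤ.∣ k)

infix 4 _≡ℤ_[mod_]

_≡ℤ_[mod_] : ℤ → ℤ → ℤ → Set
x ≡ℤ y [mod m ] = m ℤ.∣ x ℤ.- y

-- Only odd (hence nonzero) t matter; T t in fact forces t to be odd, since
-- N β is odd when β ≡ 1 (mod 8O).
T : ℤ → Set
T t = ∃[ A ] ∃[ β ]
  ( Odd A
  × t ≡ A ℤ.* N β
  × β ≡ᴼ ι 1ℤ [mod ι (+ 8) ]
  × ι A ≡ᴼ β [mod λᴼ ] )

{-# OPTIONS --safe #-}

-- The determinant of a ∈ ℤ[C₂³ × C₃] is the product, over the eight characters χ of C₂³, of
-- σ(a_χ) N(a_χ(ω)), where a_χ ∈ ℤ[C₃] and σ is the sum of the coefficients: a group matrix of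
-- C₂ × H is a block matrix with rows (A, B) and (B, A), hence has determinant det(A + B) det(A - B),
-- and this splits off the three factors C₂ one at a time. Put A = ∏ σ(a_χ) and β = ∏ η a_χ(ω), where
-- the unit η ∈ {1, ω, ω²} makes the factor of the trivial character congruent to 1 modulo 2. Since
-- σ(b) ≡ b(ω) and η ≡ 1 modulo λ, also A ≡ β. Both A and β are 1 modulo 8: the four factors with a
-- fixed value of χ on the first generator multiply to 1 + 4m, and m modulo 2 is the same for both
-- values. Conversely, if A = 1 + 8α and β = 1 + 8γ, then A ≡ β modulo λ is solvability of
-- r + s + t = α and r + sω + tω² = γ, and the special element takes the value
-- 1 + 8(r + sz + tz²) at the trivial character of C₂³ and 1 at the other seven.

module Submission where

open import Defs
open import Data.Integer.Base using (ℤ; +_; 1ℤ)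
open import Data.Product.Base using (_×_; ∃-syntax)
open import Function.Bundles using (_⇔_)
open import Relation.Binary.PropositionalEquality using (_≡_)

open import Algebra.Bundles using (CommutativeRing)
open import Data.Fin.Base
  using (Fin; zero; suc; toℕ; fromℕ<; punchIn; splitAt; _↑ˡ_; _↑ʳ_; combine; remQuot)
import Data.Fin.Properties as Fin
open import Data.Integer.Base
  using (+0; +[1+_]; -[1+_]; 0ℤ; -1ℤ; _+_; _*_; _-_; -_; +-*-rawSemiring)
open import Data.Integer.DivMod using (_%ℕ_; _/ℕ_; a≡a%ℕn+[a/ℕn]*n; n%ℕd<d)
open import Data.Integer.Divisibility.Signed using (divides; ∣m⇒∣m*n; ∣n⇒∣m*n)
open import Data.Integer.Properties
open import Data.Integer.Tactic.RingSolver using (solve-∀)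
open import Algebra.Definitions.RawSemiring +-*-rawSemiring using () renaming (_^_ to _^ᴿ_)
open import Algebra.Properties.Semiring.Sum +-*-semiring
  using (sum; sum-cong-≗; sum-replicate-zero; ∑-distrib-+; ∑-comm; *-distribˡ-sum; *-distribʳ-sum)
open import Data.Maybe.Base using (just; nothing)
open import Data.Nat.Base as ℕ using (ℕ; zero; suc; nonZero; s≤s)
open import Data.Nat.Properties using () renaming (≤-refl to ≤ℕ-refl; <⇒≤ to <⇒≤ℕ)
open import Data.Product.Base using (_,_; proj₂; uncurry; zip)
open import Data.Sum.Base using (_⊎_; inj₁; inj₂)
open import Function.Base using (_∘_; flip)
open import Function.Bundles using (mk⇔)
open import Level using (0ℓ)
open import Relation.Binary.PropositionalEquality
  using (_≢_; refl; sym; trans; cong; cong₂; subst; subst₂; isEquivalence; module ≡-Reasoning)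
open import Relation.Nullary.Decidable using (from-yes)
open import Relation.Nullary.Decidable.Core using (yes; no)
open import Relation.Nullary.Negation.Core using (contradiction)
import Tactic.RingSolver as RingSolver
open import Tactic.RingSolver.Core.AlmostCommutativeRing
  using (AlmostCommutativeRing; fromCommutativeRing)

-- Determinants

Matrix : ℕ → Set
Matrix n = Fin n → Fin n → ℤ

sgn : ∀ {n} → Fin n → ℤ
sgn j = -1ℤ ^ᴿ toℕ j

minor : ∀ {n} → Matrix (suc n) → Fin (suc n) → Matrix n
minor M j i k = M (suc i) (punchIn j k)

sum-zero : ∀ {n} (f : Fin n → ℤ) → (∀ i → f i ≡ 0ℤ) → sum f ≡ 0ℤ
sum-zero {n} f f≡0 = trans (sum-cong-≗ f≡0) (sum-replicate-zero n)

det-cong : ∀ n {M M′ : Matrix n} → (∀ i j → M i j ≡ M′ i j) → det n M ≡ det n M′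
det-cong zero    M≡M′ = refl
det-cong (suc n) M≡M′ = sum-cong-≗ λ j →
  cong₂ (λ x y → sgn j * x * y) (M≡M′ zero j) (det-cong n λ i k → M≡M′ (suc i) (punchIn j k))

-- In each term of the expansion exactly one factor involves row `r`: the entry when `r` is the
-- first row, otherwise the minor, where induction applies.
det-linear : ∀ n {A B C : Matrix n} (r : Fin n) c →
  (∀ j → C r j ≡ A r j + c * B r j) →
  (∀ i → i ≢ r → ∀ j → C i j ≡ A i j) →
  (∀ i → i ≢ r → ∀ j → C i j ≡ B i j) →
  det n C ≡ det n A + c * det n B
det-linear (suc n) {A} {B} {C} r c atr offA offB = begin
  sum (term C)                            ≡⟨ sum-cong-≗ (pointwise r atr offA offB) ⟩
  sum (λ j → term A j + c * term B j)     ≡⟨ ∑-distrib-+ (term A) (λ j → c * term B j) ⟩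
  sum (term A) + sum (λ j → c * term B j) ≡⟨ cong (_+_ (sum (term A))) (*-distribˡ-sum c (term B)) ⟨
  sum (term A) + c * sum (term B)         ∎
  where
  open ≡-Reasoning
  term : Matrix (suc n) → Fin (suc n) → ℤ
  term M j = sgn j * M zero j * det n (minor M j)

  first-row : ∀ s a b c d → s * (a + c * b) * d ≡ s * a * d + c * (s * b * d)
  first-row = solve-∀

  later-row : ∀ s a c d e → s * a * (d + c * e) ≡ s * a * d + c * (s * a * e)
  later-row = solve-∀

  pointwise : ∀ r →
    (∀ j → C r j ≡ A r j + c * B r j) →
    (∀ i → i ≢ r → ∀ j → C i j ≡ A i j) →
    (∀ i → i ≢ r → ∀ j → C i j ≡ B i j) →
    ∀ j → term C j ≡ term A j + c * term B j
  pointwise zero atr offA offB j = begin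
    sgn j * C zero j * det n (minor C j)
      ≡⟨ cong (λ x → sgn j * x * det n (minor C j)) (atr j) ⟩
    sgn j * (A zero j + c * B zero j) * det n (minor C j)
      ≡⟨ first-row (sgn j) (A zero j) (B zero j) c (det n (minor C j)) ⟩
    sgn j * A zero j * det n (minor C j) + c * (sgn j * B zero j * det n (minor C j))
      ≡⟨ cong₂ (λ x y → sgn j * A zero j * x + c * (sgn j * B zero j * y))
               (det-cong n λ i k → offA (suc i) (λ ()) (punchIn j k))
               (det-cong n λ i k → offB (suc i) (λ ()) (punchIn j k)) ⟩
    term A j + c * term B j ∎
  pointwise (suc r) atr offA offB j = begin
    sgn j * C zero j * det n (minor C j)
      ≡⟨ cong (_*_ (sgn j * C zero j)) (det-linear n r c (λ k → atr (punchIn j k))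
           (λ i i≢r k → offA (suc i) (i≢r ∘ Fin.suc-injective) (punchIn j k))
           (λ i i≢r k → offB (suc i) (i≢r ∘ Fin.suc-injective) (punchIn j k))) ⟩
    sgn j * C zero j * (det n (minor A j) + c * det n (minor B j))
      ≡⟨ later-row (sgn j) (C zero j) c (det n (minor A j)) (det n (minor B j)) ⟩
    sgn j * C zero j * det n (minor A j) + c * (sgn j * C zero j * det n (minor B j))
      ≡⟨ cong₂ (λ x y → sgn j * x * det n (minor A j) + c * (sgn j * y * det n (minor B j)))
               (offA zero (λ ()) j) (offB zero (λ ()) j) ⟩
    term A j + c * term B j ∎

-- (j , k) stands for the ordered pair of distinct columns j and punchIn j k;
-- Flip relates it to the encoding (j′ , k′) of the reversed pair.
data Flip : ∀ {n} → Fin (suc n) → Fin n → Fin (suc n) → Fin n → Set where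
  fwd  : ∀ {n} {k : Fin (suc n)} → Flip zero k (suc k) zero
  bwd  : ∀ {n} {k : Fin (suc n)} → Flip (suc k) zero zero k
  both : ∀ {n} {j j′} {k k′ : Fin n} → Flip j k j′ k′ → Flip (suc j) (suc k) (suc j′) (suc k′)

Flip-punchIn : ∀ {n j j′} {k k′ : Fin n} → Flip j k j′ k′ → punchIn j k ≡ j′
Flip-punchIn fwd      = refl
Flip-punchIn bwd      = refl
Flip-punchIn (both f) = cong suc (Flip-punchIn f)

Flip-sym : ∀ {n j j′} {k k′ : Fin n} → Flip j k j′ k′ → Flip j′ k′ j k
Flip-sym fwd      = bwd
Flip-sym bwd      = fwd
Flip-sym (both f) = both (Flip-sym f)

Flip-sgn : ∀ {n j j′} {k k′ : Fin n} → Flip j k j′ k′ → sgn j * sgn k ≡ - (sgn j′ * sgn k′)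
Flip-sgn (fwd {k = k}) = lemma (sgn k)
  where
  lemma : ∀ x → 1ℤ * x ≡ - ((-1ℤ * x) * 1ℤ)
  lemma = solve-∀
Flip-sgn (bwd {k = k}) = lemma (sgn k)
  where
  lemma : ∀ x → (-1ℤ * x) * 1ℤ ≡ - (1ℤ * x)
  lemma = solve-∀
Flip-sgn (both {j = j} {j′} {k} {k′} f) =
  trans (lemma (sgn j) (sgn k)) (trans (Flip-sgn f) (cong -_ (sym (lemma (sgn j′) (sgn k′)))))
  where
  lemma : ∀ x y → (-1ℤ * x) * (-1ℤ * y) ≡ x * y
  lemma = solve-∀

Flip-punchIn² : ∀ {n j j′} {k k′ : Fin (suc n)} → Flip j k j′ k′ →
  ∀ x → punchIn j (punchIn k x) ≡ punchIn j′ (punchIn k′ x)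
Flip-punchIn² fwd      x = refl
Flip-punchIn² bwd      x = refl
Flip-punchIn² (both f) zero = refl
Flip-punchIn² {n = suc _} (both f) (suc x) = cong suc (Flip-punchIn² f x)

-- The three pieces follow the constructors of `Flip`: row zero holds the pairs of `fwd`, the first
-- column of the remaining rows those of `bwd`, and the rest those of `both`.
∑∑-split : ∀ {n} (F : Fin (suc (suc n)) → Fin (suc n) → ℤ) →
  sum (λ j → sum (F j)) ≡
  sum (F zero) + (sum (λ j → F (suc j) zero) + sum (λ j → sum (λ k → F (suc j) (suc k))))
∑∑-split F = cong (_+_ (sum (F zero))) (∑-distrib-+ (λ j → F (suc j) zero) (λ j → sum (λ k → F (suc j) (suc k))))

-- Reversal is a bijection on ordered pairs of distinct columns, so termwise cancellation along
-- `Flip` cancels the two double sums.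
∑∑-flip : ∀ {n} (F F′ : Fin (suc n) → Fin n → ℤ) →
  (∀ {j k j′ k′} → Flip j k j′ k′ → F j k + F′ j′ k′ ≡ 0ℤ) →
  sum (λ j → sum (F j)) + sum (λ j → sum (F′ j)) ≡ 0ℤ
∑∑-flip {zero}  F F′ F+F′≡0 = refl
∑∑-flip {suc n} F F′ F+F′≡0 = begin
  sum (λ j → sum (F j)) + sum (λ j → sum (F′ j))
    ≡⟨ cong₂ _+_ (∑∑-split F) (∑∑-split F′) ⟩
  (row F + (col F + rest F)) + (row F′ + (col F′ + rest F′))
    ≡⟨ regroup (row F) (col F) (rest F) (row F′) (col F′) (rest F′) ⟩
  (row F + col F′) + (col F + row F′) + (rest F + rest F′)
    ≡⟨ cong₂ _+_ (cong₂ _+_ (cancel (F zero) (λ k → F′ (suc k) zero) λ k → F+F′≡0 fwd)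
                            (cancel (λ k → F (suc k) zero) (F′ zero) λ k → F+F′≡0 bwd))
                 (∑∑-flip (λ j k → F (suc j) (suc k)) (λ j k → F′ (suc j) (suc k)) λ f → F+F′≡0 (both f)) ⟩
  0ℤ ∎
  where
  open ≡-Reasoning
  row col rest : (Fin (suc (suc n)) → Fin (suc n) → ℤ) → ℤ
  row  F = sum (F zero)
  col  F = sum (λ j → F (suc j) zero)
  rest F = sum (λ j → sum (λ k → F (suc j) (suc k)))

  regroup : ∀ a b c d e f → (a + (b + c)) + (d + (e + f)) ≡ (a + e) + (b + d) + (c + f)
  regroup = solve-∀

  cancel : ∀ {n} (f g : Fin n → ℤ) → (∀ k → f k + g k ≡ 0ℤ) → sum f + sum g ≡ 0ℤ
  cancel f g f+g≡0 = trans (sym (∑-distrib-+ f g)) (sum-zero (λ k → f k + g k) f+g≡0)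

det-expand² : ∀ n (M : Matrix (suc (suc n))) →
  det (suc (suc n)) M ≡ sum λ j → sum λ k →
    sgn j * M zero j * (sgn k * M (suc zero) (punchIn j k) * det n (minor (minor M j) k))
det-expand² n M = sum-cong-≗ λ j → *-distribˡ-sum (sgn j * M zero j)
  λ k → sgn k * M (suc zero) (punchIn j k) * det n (minor (minor M j) k)

-- After expansion along the first two rows, swapping them reverses each ordered pair of columns.
-- The sign changes while the remaining minor stays the same. The additive form with `M′` equal to
-- `M` gives that twice the determinant is zero.
det-swap : ∀ n {M M′ : Matrix (suc (suc n))} →
  (∀ j → M′ zero j ≡ M (suc zero) j) →
  (∀ j → M′ (suc zero) j ≡ M zero j) →
  (∀ i j → M′ (suc (suc i)) j ≡ M (suc (suc i)) j) →
  det (suc (suc n)) M + det (suc (suc n)) M′ ≡ 0ℤ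
det-swap n {M} {M′} row₀ row₁ rest =
  trans (cong₂ _+_ (det-expand² n M) (det-expand² n M′)) (∑∑-flip (term M) (term M′) cancel)
  where
  open ≡-Reasoning
  term : Matrix (suc (suc n)) → Fin (suc (suc n)) → Fin (suc n) → ℤ
  term M j k = sgn j * M zero j * (sgn k * M (suc zero) (punchIn j k) * det n (minor (minor M j) k))

  collect : ∀ a b c d e → a * b * (c * d * e) ≡ (a * c) * (b * d * e)
  collect = solve-∀

  negated : ∀ s x y d → - s * (x * y * d) + s * (y * x * d) ≡ 0ℤ
  negated = solve-∀

  cancel : ∀ {j k j′ k′} → Flip j k j′ k′ → term M j k + term M′ j′ k′ ≡ 0ℤ
  cancel {j} {k} {j′} {k′} f = begin
    term M j k + term M′ j′ k′
      ≡⟨ cong₂ _+_ (collect (sgn j) (M zero j) (sgn k) (M (suc zero) (punchIn j k)) D)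
                   (collect (sgn j′) (M′ zero j′) (sgn k′) (M′ (suc zero) (punchIn j′ k′)) D′) ⟩
    sgn j * sgn k * (M zero j * M (suc zero) (punchIn j k) * D)
    + sgn j′ * sgn k′ * (M′ zero j′ * M′ (suc zero) (punchIn j′ k′) * D′)
      ≡⟨ cong₂ (λ s d → s * (M zero j * M (suc zero) (punchIn j k) * D) + sgn j′ * sgn k′ * d)
               (Flip-sgn f)
               (cong₂ _*_ (cong₂ _*_ (trans (row₀ j′) (cong (M (suc zero)) (sym (Flip-punchIn f))))
                                     (trans (row₁ _) (cong (M zero) (Flip-punchIn (Flip-sym f)))))
                          D′≡D) ⟩
    - (sgn j′ * sgn k′) * (M zero j * M (suc zero) (punchIn j k) * D)
    + sgn j′ * sgn k′ * (M (suc zero) (punchIn j k) * M zero j * D)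
      ≡⟨ negated (sgn j′ * sgn k′) (M zero j) (M (suc zero) (punchIn j k)) D ⟩
    0ℤ ∎
    where
    D D′ : ℤ
    D  = det n (minor (minor M j) k)
    D′ = det n (minor (minor M′ j′) k′)
    D′≡D : D′ ≡ D
    D′≡D = det-cong n λ i x → trans (rest i _) (cong (M (suc (suc i))) (sym (Flip-punchIn² f x)))

x+x≡0⇒x≡0 : ∀ x → x + x ≡ 0ℤ → x ≡ 0ℤ
x+x≡0⇒x≡0 (+ zero)  _ = refl
x+x≡0⇒x≡0 +[1+ n ]  ()
x+x≡0⇒x≡0 -[1+ n ]  ()

-- Equal rows below the first are handled by expanding along the first row, since every minor again
-- has two equal rows. If the first row is one of the two, either the other is the second, and
-- swapping shows that twice the determinant is zero, or swapping the first two rows puts both equal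
-- rows below the first.
det-equal-rows : ∀ n (M : Matrix n) (r s : Fin n) → r ≢ s → (∀ j → M r j ≡ M s j) → det n M ≡ 0ℤ
det-equal-suc-rows : ∀ n (M : Matrix (suc n)) (r s : Fin n) → r ≢ s →
  (∀ j → M (suc r) j ≡ M (suc s) j) → det (suc n) M ≡ 0ℤ
det-equal-first-row : ∀ n (M : Matrix (suc n)) (s : Fin n) →
  (∀ j → M zero j ≡ M (suc s) j) → det (suc n) M ≡ 0ℤ

det-equal-rows (suc n) M zero zero r≢s eq = contradiction refl r≢s
det-equal-rows (suc n) M (suc r) (suc s) r≢s eq = det-equal-suc-rows n M r s (r≢s ∘ cong suc) eq
det-equal-rows (suc n) M zero (suc s) r≢s eq = det-equal-first-row n M s eq
det-equal-rows (suc n) M (suc r) zero r≢s eq = det-equal-first-row n M r (sym ∘ eq)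

det-equal-first-row (suc n) M zero eq =
  x+x≡0⇒x≡0 _ (det-swap n {M} {M} eq (sym ∘ eq) (λ _ _ → refl))
det-equal-first-row (suc n) M (suc s) eq = begin
  det _ M               ≡⟨ +-identityʳ _ ⟨
  det _ M + 0ℤ          ≡⟨ cong (_+_ (det _ M)) (det-equal-suc-rows (suc n) M′ zero (suc s) (λ ()) eq) ⟨
  det _ M + det _ M′    ≡⟨ det-swap n {M} {M′} (λ _ → refl) (λ _ → refl) (λ _ _ → refl) ⟩
  0ℤ                    ∎
  where
  open ≡-Reasoning
  M′ : Matrix (suc (suc n))
  M′ zero          = M (suc zero)
  M′ (suc zero)    = M zero
  M′ (suc (suc i)) = M (suc (suc i))

det-equal-suc-rows n M r s r≢s eq = sum-zero (λ j → sgn j * M zero j * det n (minor M j)) λ j →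
  trans (cong (_*_ (sgn j * M zero j)) (det-equal-rows n (minor M j) r s r≢s (λ k → eq (punchIn j k))))
        (*-zeroʳ (sgn j * M zero j))

-- By linearity in row `r`, the change is `c` times the determinant of a matrix `B` in which row `s`
-- occurs twice.
det-addRow : ∀ n {M M′ : Matrix n} (r s : Fin n) c → r ≢ s →
  (∀ j → M′ r j ≡ M r j + c * M s j) →
  (∀ i → i ≢ r → ∀ j → M′ i j ≡ M i j) →
  det n M′ ≡ det n M
det-addRow n {M} {M′} r s c r≢s atr off = begin
  det n M′             ≡⟨ det-linear n r c (λ j → trans (atr j) (cong (λ x → M r j + c * x) (sym (B-r j))))
                            off (λ i i≢r j → trans (off i i≢r j) (sym (B-off i i≢r j))) ⟩
  det n M + c * det n B ≡⟨ cong (λ x → det n M + c * x) (det-equal-rows n B r s r≢s λ j →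
                            trans (B-r j) (sym (B-off s (r≢s ∘ sym) j))) ⟩
  det n M + c * 0ℤ      ≡⟨ cong (_+_ (det n M)) (*-zeroʳ c) ⟩
  det n M + 0ℤ          ≡⟨ +-identityʳ _ ⟩
  det n M               ∎
  where
  open ≡-Reasoning
  B : Matrix n
  B i with i Fin.≟ r
  ... | yes _ = M s
  ... | no  _ = M i

  B-r : ∀ j → B r j ≡ M s j
  B-r j with r Fin.≟ r
  ... | yes _   = refl
  ... | no  r≢r = contradiction refl r≢r

  B-off : ∀ i → i ≢ r → ∀ j → B i j ≡ M i j
  B-off i i≢r j with i Fin.≟ r
  ... | yes i≡r = contradiction i≡r i≢r
  ... | no  _   = refl

-- Interpolates between the zero function and `c`, so that row additions can be carried out one row
-- at a time.
truncate : ∀ {n} → ℕ → (Fin n → ℤ) → Fin n → ℤ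
truncate zero    c i       = 0ℤ
truncate (suc k) c zero    = c zero
truncate (suc k) c (suc i) = truncate k (c ∘ suc) i

truncate-all : ∀ {n} (c : Fin n → ℤ) i → truncate n c i ≡ c i
truncate-all c zero    = refl
truncate-all c (suc i) = truncate-all (c ∘ suc) i

truncate-≡0 : ∀ {n} k (c : Fin n → ℤ) i → c i ≡ 0ℤ → truncate k c i ≡ 0ℤ
truncate-≡0 zero    c i       eq = refl
truncate-≡0 (suc k) c zero    eq = eq
truncate-≡0 (suc k) c (suc i) eq = truncate-≡0 k (c ∘ suc) i eq

truncate-at : ∀ {n} (c : Fin n → ℤ) r → truncate (toℕ r) c r ≡ 0ℤ
truncate-at c zero    = refl
truncate-at c (suc r) = truncate-at (c ∘ suc) r

truncate-suc-at : ∀ {n} (c : Fin n → ℤ) r → truncate (suc (toℕ r)) c r ≡ c r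
truncate-suc-at c zero    = refl
truncate-suc-at c (suc r) = truncate-suc-at (c ∘ suc) r

truncate-suc-off : ∀ {n} (c : Fin n → ℤ) r i → i ≢ r →
  truncate (suc (toℕ r)) c i ≡ truncate (toℕ r) c i
truncate-suc-off c zero    zero    i≢r = contradiction refl i≢r
truncate-suc-off c (suc r) zero    i≢r = refl
truncate-suc-off c zero    (suc i) i≢r = refl
truncate-suc-off c (suc r) (suc i) i≢r = truncate-suc-off (c ∘ suc) r i (i≢r ∘ cong suc)

-- The hypothesis says that the rows being added are themselves left unchanged.
det-addRows : ∀ n (M : Matrix n) (c : Fin n → ℤ) (t : Fin n → Fin n) → (∀ i → c (t i) ≡ 0ℤ) →
  det n (λ i j → M i j + c i * M (t i) j) ≡ det n M
det-addRows n M c t ct≡0 =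
  trans (det-cong n λ i j → cong (λ x → M i j + x * M (t i) j) (sym (truncate-all c i)))
        (steps n ≤ℕ-refl)
  where
  stage : ℕ → Matrix n
  stage k i j = M i j + truncate k c i * M (t i) j
  steps : ∀ k → k ℕ.≤ n → det n (stage k) ≡ det n M
  step : ∀ r → det n (stage (suc (toℕ r))) ≡ det n (stage (toℕ r))
  step r with r Fin.≟ t r
  -- Here `c r` equals `c (t r)`, which is zero, so this stage adds nothing.
  ... | yes r≡tr = det-cong n λ i j → cong (λ x → M i j + x * M (t i) j) (same i)
    where
    same : ∀ i → truncate (suc (toℕ r)) c i ≡ truncate (toℕ r) c i
    same i with i Fin.≟ r
    ... | yes refl = trans (truncate-suc-at c r) (trans (trans (cong c r≡tr) (ct≡0 r)) (sym (truncate-at c r)))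
    ... | no  i≢r  = truncate-suc-off c r i i≢r
  -- Row `t r` is the same at every stage because `c (t r)` is zero, so adding it from the current
  -- stage adds the original row.
  ... | no  r≢tr = det-addRow n r (t r) (c r) r≢tr
    (λ j → begin
      M r j + truncate (suc (toℕ r)) c r * M (t r) j
        ≡⟨ cong (λ x → M r j + x * M (t r) j) (truncate-suc-at c r) ⟩
      M r j + c r * M (t r) j
        ≡⟨ zeros (M r j) (c r) (M (t r) j) (M (t (t r)) j) ⟩
      M r j + 0ℤ * M (t r) j + c r * (M (t r) j + 0ℤ * M (t (t r)) j)
        ≡⟨ cong₂ (λ x y → M r j + x * M (t r) j + c r * (M (t r) j + y * M (t (t r)) j))
             (truncate-at c r) (truncate-≡0 (toℕ r) c (t r) (ct≡0 r)) ⟨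
      stage (toℕ r) r j + c r * stage (toℕ r) (t r) j ∎)
    (λ i i≢r j → cong (λ x → M i j + x * M (t i) j) (truncate-suc-off c r i i≢r))
    where
    open ≡-Reasoning
    zeros : ∀ a b c d → a + b * c ≡ a + 0ℤ * c + b * (c + 0ℤ * d)
    zeros = solve-∀

  steps zero    _   = det-cong n λ i j → +-identityʳ (M i j)
  steps (suc k) k<n = trans
    (subst (λ l → det n (stage (suc l)) ≡ det n (stage l)) (Fin.toℕ-fromℕ< k<n) (step (fromℕ< k<n)))
    (steps k (<⇒≤ℕ k<n))

-- Expand along the first row and then, using induction for the minors, along the first column.
-- Apart from the corner term this is a double sum over an entry of the first row and an entry of
-- the first column, and transposing exchanges the two indices.
det-transpose : ∀ n (M : Matrix n) → det n (flip M) ≡ det n M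
det-transpose zero          M = refl
det-transpose (suc zero)    M = refl
det-transpose (suc (suc n)) M = begin
  det _ (flip M)
    ≡⟨ expand (det-transpose (suc n)) (flip M) ⟩
  corner (flip M) + sum (λ j → sum λ i → term (flip M) i j)
    ≡⟨ cong₂ _+_ (cong (_*_ (1ℤ * M zero zero)) (det-transpose (suc n) (minor M zero)))
                 (sum-cong-≗ λ j → sum-cong-≗ λ i → term-flip i j) ⟩
  corner M + sum (λ j → sum λ i → term M j i)
    ≡⟨ cong (_+_ (corner M)) (∑-comm (term M)) ⟩
  corner M + sum (λ j → sum λ i → term M i j)
    ≡⟨ expand (det-transpose (suc n)) M ⟨
  det _ M ∎
  where
  open ≡-Reasoning
  minor² : Matrix (suc (suc n)) → Fin (suc n) → Fin (suc n) → Matrix n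
  -- The indices `a` and `b` are exchanged because this is a minor of the transpose of
  -- `minor M (suc j)`.
  minor² M i j a b = M (suc (punchIn i b)) (suc (punchIn j a))

  term : Matrix (suc (suc n)) → Fin (suc n) → Fin (suc n) → ℤ
  term M i j = -1ℤ * sgn j * M zero (suc j) * (sgn i * M (suc i) zero * det n (minor² M i j))

  corner : Matrix (suc (suc n)) → ℤ
  corner M = 1ℤ * M zero zero * det (suc n) (minor M zero)

  expand : (∀ M → det (suc n) (flip M) ≡ det (suc n) M) →
    ∀ M → det (suc (suc n)) M ≡ corner M + sum λ j → sum λ i → term M i j
  expand transpose M = cong (_+_ (corner M)) (sum-cong-≗ λ j → trans
    (cong (_*_ (-1ℤ * sgn j * M zero (suc j))) (sym (transpose (minor M (suc j)))))
    (*-distribˡ-sum (-1ℤ * sgn j * M zero (suc j)) λ i → sgn i * M (suc i) zero * det n (minor² M i j)))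

  exchange : ∀ s t x y d → -1ℤ * s * x * (t * y * d) ≡ -1ℤ * t * y * (s * x * d)
  exchange = solve-∀

  term-flip : ∀ i j → term (flip M) i j ≡ term M j i
  term-flip i j = trans
    (exchange (sgn j) (sgn i) (M (suc j) zero) (M zero (suc i)) (det n (minor² (flip M) i j)))
    (cong (λ d → -1ℤ * sgn i * M zero (suc i) * (sgn j * M (suc j) zero * d))
          (det-transpose n (minor² M j i)))

-- Block-triangular matrices

sum-+ : ∀ m n (f : Fin (m ℕ.+ n) → ℤ) → sum f ≡ sum (f ∘ (_↑ˡ n)) + sum (f ∘ (m ↑ʳ_))
sum-+ zero    n f = sym (+-identityˡ (sum f))
sum-+ (suc m) n f =
  trans (cong (_+_ (f zero)) (sum-+ m n (f ∘ suc)))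
        (sym (+-assoc (f zero) (sum (f ∘ suc ∘ (_↑ˡ n))) (sum (f ∘ suc ∘ (m ↑ʳ_)))))

punchIn-↑ˡ-↑ˡ : ∀ {m} n (j : Fin (suc m)) (k : Fin m) → punchIn (j ↑ˡ n) (k ↑ˡ n) ≡ punchIn j k ↑ˡ n
punchIn-↑ˡ-↑ˡ n zero    k       = refl
punchIn-↑ˡ-↑ˡ n (suc j) zero    = refl
punchIn-↑ˡ-↑ˡ n (suc j) (suc k) = cong suc (punchIn-↑ˡ-↑ˡ n j k)

punchIn-↑ˡ-↑ʳ : ∀ {m} n (j : Fin (suc m)) (k : Fin n) → punchIn (j ↑ˡ n) (m ↑ʳ k) ≡ suc m ↑ʳ k
punchIn-↑ˡ-↑ʳ         n zero    k = refl
punchIn-↑ˡ-↑ʳ {suc m} n (suc j) k = cong suc (punchIn-↑ˡ-↑ʳ n j k)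

-- In the expansion along the first row the columns of the right block contribute zero. Each
-- remaining minor is again block triangular with the same lower right block, which therefore
-- factors out.
det-blockTriangular : ∀ m n (M : Matrix (m ℕ.+ n)) → (∀ i j → M (i ↑ˡ n) (m ↑ʳ j) ≡ 0ℤ) →
  det (m ℕ.+ n) M ≡ det m (λ i j → M (i ↑ˡ n) (j ↑ˡ n)) * det n (λ i j → M (m ↑ʳ i) (m ↑ʳ j))
det-blockTriangular zero    n M M≡0 = sym (*-identityˡ (det n M))
det-blockTriangular (suc m) n M M≡0 = begin
  sum term
    ≡⟨ sum-+ (suc m) n term ⟩
  sum (term ∘ (_↑ˡ n)) + sum (term ∘ (suc m ↑ʳ_))
    ≡⟨ cong₂ _+_ (sum-cong-≗ left) (sum-zero (term ∘ (suc m ↑ʳ_)) right) ⟩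
  sum (λ j → termᴾ j * D) + 0ℤ
    ≡⟨ +-identityʳ _ ⟩
  sum (λ j → termᴾ j * D)
    ≡⟨ *-distribʳ-sum D termᴾ ⟨
  sum termᴾ * D ∎
  where
  open ≡-Reasoning
  P : Matrix (suc m)
  P i j = M (i ↑ˡ n) (j ↑ˡ n)
  D : ℤ
  D = det n (λ i j → M (suc m ↑ʳ i) (suc m ↑ʳ j))

  term : Fin (suc m ℕ.+ n) → ℤ
  term j = sgn j * M zero j * det (m ℕ.+ n) (minor M j)

  termᴾ : Fin (suc m) → ℤ
  termᴾ j = sgn j * P zero j * det m (minor P j)

  right : ∀ j → term (suc m ↑ʳ j) ≡ 0ℤ
  right j = trans (cong (λ x → s * x * d) (M≡0 zero j)) (cong (_* d) (*-zeroʳ s))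
    where
    s d : ℤ
    s = sgn (suc m ↑ʳ j)
    d = det (m ℕ.+ n) (minor M (suc m ↑ʳ j))

  left : ∀ j → term (j ↑ˡ n) ≡ termᴾ j * D
  left j = let N = minor M (j ↑ˡ n) in begin
    sgn (j ↑ˡ n) * P zero j * det (m ℕ.+ n) N
      ≡⟨ cong₂ (λ k d → -1ℤ ^ᴿ k * P zero j * d) (Fin.toℕ-↑ˡ j n)
           (det-blockTriangular m n N λ i k →
             trans (cong (M (suc (i ↑ˡ n))) (punchIn-↑ˡ-↑ʳ n j k)) (M≡0 (suc i) k)) ⟩
    sgn j * P zero j * (det m (λ i k → N (i ↑ˡ n) (k ↑ˡ n)) * det n (λ i k → N (m ↑ʳ i) (m ↑ʳ k)))
      ≡⟨ cong₂ (λ x y → sgn j * P zero j * (x * y))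
           (det-cong m λ i k → cong (M (suc (i ↑ˡ n))) (punchIn-↑ˡ-↑ˡ n j k))
           (det-cong n λ i k → cong (M (suc m ↑ʳ i)) (punchIn-↑ˡ-↑ʳ n j k)) ⟩
    sgn j * P zero j * (det m (minor P j) * D)
      ≡⟨ *-assoc (sgn j * P zero j) _ _ ⟨
    termᴾ j * D ∎

-- The number `2 * n` unfolds to `n + (n + 0)`, so the lower right block first appears with size
-- `n + 0`.
det-+0 : ∀ n (M : Matrix (n ℕ.+ 0)) → det (n ℕ.+ 0) M ≡ det n (λ i j → M (i ↑ˡ 0) (j ↑ˡ 0))
det-+0 n M = trans (det-blockTriangular n 0 M λ i ()) (*-identityʳ _)

-- Matrices with two block rows and two block columns

BlockMatrix : ℕ → Set
BlockMatrix n = Fin 2 × Fin n → Fin 2 × Fin n → ℤ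

-- The pairs are listed by `remQuot` because this is how `_×ᴳ_` enumerates a direct product with
-- `cyclic 2`.
blockDet : ∀ n → BlockMatrix n → ℤ
blockDet n F = det (2 ℕ.* n) λ x y → F (remQuot n x) (remQuot n y)

pattern 0₂ = Fin.zero
pattern 1₂ = Fin.suc Fin.zero

blockDet-addRows : ∀ n (F : BlockMatrix n) c t → (∀ p → c (t p) ≡ 0ℤ) →
  blockDet n (λ p q → F p q + c p * F (t p) q) ≡ blockDet n F
blockDet-addRows n F c t ct≡0 = trans
  (det-cong (2 ℕ.* n) λ x y →
    cong (λ p → F (remQuot n x) (remQuot n y) + c (remQuot n x) * F p (remQuot n y)) (sym (rq-t x)))
  (det-addRows (2 ℕ.* n) (λ x y → F (remQuot n x) (remQuot n y)) (c ∘ remQuot n)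
    (uncurry combine ∘ t ∘ remQuot n) λ x → trans (cong c (rq-t x)) (ct≡0 (remQuot n x)))
  where
  rq-t : ∀ x → remQuot n (uncurry combine (t (remQuot n x))) ≡ t (remQuot n x)
  rq-t x = Fin.remQuot-combine _ _

blockDet-transpose : ∀ n (F : BlockMatrix n) → blockDet n (flip F) ≡ blockDet n F
blockDet-transpose n F = det-transpose (2 ℕ.* n) λ x y → F (remQuot n x) (remQuot n y)

blockDet-triangular : ∀ n (F : BlockMatrix n) → (∀ i j → F (0₂ , i) (1₂ , j) ≡ 0ℤ) →
  blockDet n F ≡ det n (λ i j → F (0₂ , i) (0₂ , j)) * det n (λ i j → F (1₂ , i) (1₂ , j))
blockDet-triangular n F F≡0 = begin
  blockDet n F
    ≡⟨ det-blockTriangular n (n ℕ.+ 0) M upper ⟩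
  det n (λ i j → M (i ↑ˡ (n ℕ.+ 0)) (j ↑ˡ (n ℕ.+ 0))) * det (n ℕ.+ 0) (λ i j → M (n ↑ʳ i) (n ↑ʳ j))
    ≡⟨ cong (_*_ (det n (λ i j → M (i ↑ˡ (n ℕ.+ 0)) (j ↑ˡ (n ℕ.+ 0)))))
            (det-+0 n (λ i j → M (n ↑ʳ i) (n ↑ʳ j))) ⟩
  det n (λ i j → M (combine {2} 0₂ i) (combine {2} 0₂ j)) *
  det n (λ i j → M (combine {2} 1₂ i) (combine {2} 1₂ j))
    ≡⟨ cong₂ _*_ (det-cong n λ i j → cong₂ F (Fin.remQuot-combine 0₂ i) (Fin.remQuot-combine 0₂ j))
                 (det-cong n λ i j → cong₂ F (Fin.remQuot-combine 1₂ i) (Fin.remQuot-combine 1₂ j)) ⟩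
  det n (λ i j → F (0₂ , i) (0₂ , j)) * det n (λ i j → F (1₂ , i) (1₂ , j)) ∎
  where
  open ≡-Reasoning
  M : Matrix (2 ℕ.* n)
  M x y = F (remQuot n x) (remQuot n y)

  remQuot-↑ʳ : ∀ j → ∃[ k ] remQuot {2} n (n ↑ʳ j) ≡ (1₂ , k)
  remQuot-↑ʳ j rewrite Fin.splitAt-↑ʳ n (n ℕ.+ 0) j with inj₁ k ← splitAt n j = k , refl

  upper : ∀ i j → M (i ↑ˡ (n ℕ.+ 0)) (n ↑ʳ j) ≡ 0ℤ
  upper i j with k , eq ← remQuot-↑ʳ j =
    trans (cong₂ F (Fin.remQuot-combine {2} 0₂ i) eq) (F≡0 i k)

-- Let the block rows be (A, B) and (B, A). Adding the second block row to the first gives (A + B, A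
-- + B) and (B, A). Subtracting the first block column from the second, as a row operation on the
-- transpose, gives (A + B, 0) and (B, A - B), which is block triangular.
det-circulant : ∀ n (F : BlockMatrix n) →
  (∀ i j → F (1₂ , i) (0₂ , j) ≡ F (0₂ , i) (1₂ , j)) →
  (∀ i j → F (1₂ , i) (1₂ , j) ≡ F (0₂ , i) (0₂ , j)) →
  blockDet n F ≡
    det n (λ i j → F (0₂ , i) (0₂ , j) + F (0₂ , i) (1₂ , j)) *
    det n (λ i j → F (0₂ , i) (0₂ , j) - F (0₂ , i) (1₂ , j))
det-circulant n F F₁₀ F₁₁ = begin
  blockDet n F
    ≡⟨ blockDet-addRows n F (weight 1ℤ 0ℤ) (to 1₂) (λ _ → refl) ⟨
  blockDet n F′
    ≡⟨ blockDet-transpose n F′ ⟨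
  blockDet n (flip F′)
    ≡⟨ blockDet-addRows n (flip F′) (weight 0ℤ -1ℤ) (to 0₂) (λ _ → refl) ⟨
  blockDet n (flip F″)
    ≡⟨ blockDet-transpose n F″ ⟩
  blockDet n F″
    ≡⟨ blockDet-triangular n F″ (λ i j → upper (F₁₀ i j) (F₁₁ i j)) ⟩
  det n (λ i j → F″ (0₂ , i) (0₂ , j)) * det n (λ i j → F″ (1₂ , i) (1₂ , j))
    ≡⟨ cong₂ _*_ (det-cong n λ i j → plus (F (0₂ , i) (0₂ , j)) (F₁₀ i j))
                 (det-cong n λ i j → minus (F (0₂ , i) (0₂ , j)) (F₁₀ i j) (F₁₁ i j)) ⟩
  det n (λ i j → F (0₂ , i) (0₂ , j) + F (0₂ , i) (1₂ , j)) *
  det n (λ i j → F (0₂ , i) (0₂ , j) - F (0₂ , i) (1₂ , j)) ∎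
  where
  open ≡-Reasoning
  weight : ℤ → ℤ → Fin 2 × Fin n → ℤ
  weight a b (0₂ , _) = a
  weight a b (1₂ , _) = b

  to : Fin 2 → Fin 2 × Fin n → Fin 2 × Fin n
  to p (_ , i) = p , i

  F′ F″ : BlockMatrix n
  F′ p q = F p q + weight 1ℤ 0ℤ p * F (to 1₂ p) q
  F″ p q = F′ p q + weight 0ℤ -1ℤ q * F′ p (to 0₂ q)

  upper : ∀ {a b c d} → c ≡ b → d ≡ a →
    (b + 1ℤ * d) + -1ℤ * (a + 1ℤ * c) ≡ 0ℤ
  upper {a} {b} refl refl = lemma a b
    where
    lemma : ∀ a b → (b + 1ℤ * a) + -1ℤ * (a + 1ℤ * b) ≡ 0ℤ
    lemma = solve-∀

  plus : ∀ a {b c} → c ≡ b → (a + 1ℤ * c) + 0ℤ * (a + 1ℤ * c) ≡ a + b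
  plus a {b} refl = lemma a b
    where
    lemma : ∀ a b → (a + 1ℤ * b) + 0ℤ * (a + 1ℤ * b) ≡ a + b
    lemma = solve-∀

  minus : ∀ a {b c d} → c ≡ b → d ≡ a → (d + 0ℤ * d) + -1ℤ * (c + 0ℤ * c) ≡ a - b
  minus a {b} refl refl = lemma a b
    where
    lemma : ∀ a b → (a + 0ℤ * a) + -1ℤ * (b + 0ℤ * b) ≡ a - b
    lemma = solve-∀

-- Group determinants

infix 9 _⁺ _⁻

-- The coefficients of the images of a ∈ ℤ[C₂ × H] in ℤ[H] under the two characters of C₂.
_⁺ _⁻ : ∀ {X : Set} → (Fin 2 × X → ℤ) → X → ℤ
(a ⁺) x = a (0₂ , x) + a (1₂ , x)
(a ⁻) x = a (0₂ , x) - a (1₂ , x)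

open GroupRing using (ℤ[G]; determinant)

opaque
  -- Opaque, so that comparing two determinants does not expand them.
  groupDet : ∀ G → ℤ[G] G → ℤ
  groupDet = determinant

  determinant≡groupDet : ∀ G a → determinant G a ≡ groupDet G a
  determinant≡groupDet G a = refl

  groupDet-cong : ∀ G (a b : ℤ[G] G) → (∀ g → a g ≡ b g) → groupDet G a ≡ groupDet G b
  groupDet-cong G a b a≡b = det-cong order λ i j → a≡b (element i ∙ element j ⁻¹)
    where open FiniteGroup G

  -- An entry involves the C₂-components `p` and `q` only through their difference modulo 2, so both
  -- circulant conditions hold by computation.
  groupDet-C₂× : ∀ H a → groupDet (cyclic 2 ×ᴳ H) a ≡ groupDet H (a ⁺) * groupDet H (a ⁻)
  groupDet-C₂× H a = det-circulant order F (λ _ _ → refl) (λ _ _ → refl)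
    where
    open FiniteGroup H
    open FiniteGroup (cyclic 2) using () renaming (_∙_ to _∙₂_; _⁻¹ to _⁻¹₂)
    F : BlockMatrix order
    F (p , i) (q , j) = a (p ∙₂ q ⁻¹₂ , element i ∙ element j ⁻¹)

σ : (Fin 3 → ℤ) → ℤ
σ b = b zero + b (suc zero) + b (suc (suc zero))

-- The value of b₀ + b₁z + b₂z² at z = ω, reduced by ω² = -1 - ω.
atω : (Fin 3 → ℤ) → O
atω b = (b zero - b (suc (suc zero))) +ω (b (suc zero) - b (suc (suc zero)))

opaque
  unfolding groupDet

  groupDet-C₃ : ∀ b → groupDet (cyclic 3) b ≡ σ b * N (atω b)
  groupDet-C₃ b = laplace (b zero) (b (suc zero)) (b (suc (suc zero)))
    where
    -- The left side is the unfolded Laplace expansion of the 3 by 3 circulant, that is x³ + y³ + z³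
    -- - 3xyz.
    laplace : ∀ x y z →
      1ℤ * x * (1ℤ * x * (1ℤ * x * 1ℤ + 0ℤ) + (-1ℤ * z * (1ℤ * y * 1ℤ + 0ℤ) + 0ℤ)) +
      (-1ℤ * z * (1ℤ * y * (1ℤ * x * 1ℤ + 0ℤ) + (-1ℤ * z * (1ℤ * z * 1ℤ + 0ℤ) + 0ℤ)) +
      (1ℤ * y * (1ℤ * y * (1ℤ * y * 1ℤ + 0ℤ) + (-1ℤ * x * (1ℤ * z * 1ℤ + 0ℤ) + 0ℤ)) + 0ℤ)) ≡
      (x + y + z) * ((x - z) * (x - z) - (x - z) * (y - z) + (y - z) * (y - z))
    laplace = solve-∀

-- The ring ℤ[ω] and congruences modulo 8

infixl 6 _+ᴼ_

_+ᴼ_ : O → O → O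
(a +ω b) +ᴼ (c +ω d) = (a + c) +ω (b + d)

negᴼ : O → O
negᴼ (a +ω b) = (- a) +ω (- b)

*ᴼ-assoc : ∀ x y z → (x *ᴼ y) *ᴼ z ≡ x *ᴼ (y *ᴼ z)
*ᴼ-assoc (a +ω b) (c +ω d) (e +ω f) = cong₂ _+ω_ (l₁ a b c d e f) (l₂ a b c d e f)
  where
  l₁ : ∀ a b c d e f → (a * c - b * d) * e - (a * d + b * c - b * d) * f
                     ≡ a * (c * e - d * f) - b * (c * f + d * e - d * f)
  l₁ = solve-∀
  l₂ : ∀ a b c d e f → (a * c - b * d) * f + (a * d + b * c - b * d) * e - (a * d + b * c - b * d) * f
                     ≡ a * (c * f + d * e - d * f) + b * (c * e - d * f) - b * (c * f + d * e - d * f)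
  l₂ = solve-∀

*ᴼ-comm : ∀ x y → x *ᴼ y ≡ y *ᴼ x
*ᴼ-comm (a +ω b) (c +ω d) = cong₂ _+ω_ (l₁ a b c d) (l₂ a b c d)
  where
  l₁ : ∀ a b c d → a * c - b * d ≡ c * a - d * b
  l₁ = solve-∀
  l₂ : ∀ a b c d → a * d + b * c - b * d ≡ c * b + d * a - d * b
  l₂ = solve-∀

*ᴼ-identityˡ : ∀ x → ι 1ℤ *ᴼ x ≡ x
*ᴼ-identityˡ (a +ω b) = cong₂ _+ω_ (l₁ a b) (l₂ a b)
  where
  l₁ : ∀ a b → 1ℤ * a - 0ℤ * b ≡ a
  l₁ = solve-∀
  l₂ : ∀ a b → 1ℤ * b + 0ℤ * a - 0ℤ * b ≡ b
  l₂ = solve-∀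

*ᴼ-distribˡ-+ᴼ : ∀ x y z → x *ᴼ (y +ᴼ z) ≡ x *ᴼ y +ᴼ x *ᴼ z
*ᴼ-distribˡ-+ᴼ (a +ω b) (c +ω d) (e +ω f) = cong₂ _+ω_ (l₁ a b c d e f) (l₂ a b c d e f)
  where
  l₁ : ∀ a b c d e f → a * (c + e) - b * (d + f) ≡ (a * c - b * d) + (a * e - b * f)
  l₁ = solve-∀
  l₂ : ∀ a b c d e f → a * (d + f) + b * (c + e) - b * (d + f)
                     ≡ (a * d + b * c - b * d) + (a * f + b * e - b * f)
  l₂ = solve-∀

O-commutativeRing : CommutativeRing 0ℓ 0ℓ
O-commutativeRing = record
  { Carrier = O ; _≈_ = _≡_ ; _+_ = _+ᴼ_ ; _*_ = _*ᴼ_ ; -_ = negᴼ ; 0# = ι 0ℤ ; 1# = ι 1ℤ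
  ; isCommutativeRing = record
    { isRing = record
      { +-isAbelianGroup = record
        { isGroup = record
          { isMonoid = record
            { isSemigroup = record
              { isMagma = record { isEquivalence = isEquivalence ; ∙-cong = cong₂ _+ᴼ_ }
              ; assoc   = λ (a +ω b) (c +ω d) (e +ω f) → cong₂ _+ω_ (+-assoc a c e) (+-assoc b d f)
              }
            ; identity = (λ (a +ω b) → cong₂ _+ω_ (+-identityˡ a) (+-identityˡ b))
                       , (λ (a +ω b) → cong₂ _+ω_ (+-identityʳ a) (+-identityʳ b))
            }
          ; inverse = (λ (a +ω b) → cong₂ _+ω_ (+-inverseˡ a) (+-inverseˡ b))
                    , (λ (a +ω b) → cong₂ _+ω_ (+-inverseʳ a) (+-inverseʳ b))
          ; ⁻¹-cong = cong negᴼ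
          }
        ; comm = λ (a +ω b) (c +ω d) → cong₂ _+ω_ (+-comm a c) (+-comm b d)
        }
      ; *-cong     = cong₂ _*ᴼ_
      ; *-assoc    = *ᴼ-assoc
      ; *-identity = *ᴼ-identityˡ , λ x → trans (*ᴼ-comm x (ι 1ℤ)) (*ᴼ-identityˡ x)
      ; distrib    = *ᴼ-distribˡ-+ᴼ , λ x y z →
          trans (*ᴼ-comm (y +ᴼ z) x)
                (trans (*ᴼ-distribˡ-+ᴼ x y z) (cong₂ _+ᴼ_ (*ᴼ-comm x y) (*ᴼ-comm x z)))
      }
    ; *-comm = *ᴼ-comm
    }
  }

O-ring : AlmostCommutativeRing 0ℓ 0ℓ
O-ring = fromCommutativeRing O-commutativeRing
  -- A one-sided zero test for the ring solver: literal zeros are recognised, and `nothing` is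
  -- always a sound answer.
  λ { (+0 +ω +0) → just refl ; _ → nothing }

open AlmostCommutativeRing O-ring using () renaming (_-_ to infixl 6 _⊟_)

-- The product, over the four characters of C₂², of the values of an element with coefficients `a`,
-- `b`, `c`, `d`.
quartic : O → O → O → O → O
quartic a b c d =
  ((a +ᴼ b) +ᴼ (c +ᴼ d)) *ᴼ ((a +ᴼ b) ⊟ (c +ᴼ d)) *ᴼ
  (((a ⊟ b) +ᴼ (c ⊟ d)) *ᴼ ((a ⊟ b) ⊟ (c ⊟ d)))

-- With s = a + b + c + d, the other factors of quartic a b c d are s - 2p, s - 2q and s - 2r
-- for p = c + d, q = b + d, r = b + c; this is pq + pr + qr - (p + q + r)/2.
quadric : O → O → O → O
quadric b c d = (c +ᴼ d) *ᴼ (b +ᴼ d) +ᴼ (c +ᴼ d) *ᴼ (b +ᴼ c) +ᴼ (b +ᴼ d) *ᴼ (b +ᴼ c) ⊟ (b +ᴼ c +ᴼ d)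

-- The first argument is chosen so that the four sum to s = 1 + 2k. With p + q + r = 2e, f = pq + pr
-- + qr and m = pqr, the product is s⁴ - 4s³e + 4s²f - 8sm. Since s is 1 modulo 2, s² is 1 modulo 4
-- and s⁴ is 1 modulo 8, which leaves 1 + 4(f - e).
quartic-expansion : ∀ k b c d → ∃[ h ]
  quartic (ι 1ℤ +ᴼ ι (+ 2) *ᴼ k ⊟ (b +ᴼ c +ᴼ d)) b c d ≡
  ι 1ℤ +ᴼ ι (+ 4) *ᴼ (quadric b c d +ᴼ ι (+ 2) *ᴼ h)
quartic-expansion k b c d = remainder k e f m , (begin
  quartic (s ⊟ e) b c d
    ≡⟨ cong₂ _*ᴼ_ (cong₂ _*ᴼ_ (factor₁ s b c d) (factor₂ s b c d))
                  (cong₂ _*ᴼ_ (factor₃ s b c d) (factor₄ s b c d)) ⟩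
  s *ᴼ (s ⊟ ι (+ 2) *ᴼ p) *ᴼ ((s ⊟ ι (+ 2) *ᴼ q) *ᴼ (s ⊟ ι (+ 2) *ᴼ r))
    ≡⟨ expand s p q r ⟩
  s *ᴼ s *ᴼ (s *ᴼ s ⊟ ι (+ 2) *ᴼ s *ᴼ (p +ᴼ q +ᴼ r) +ᴼ ι (+ 4) *ᴼ f) ⊟ ι (+ 8) *ᴼ s *ᴼ m
    ≡⟨ cong (λ x → s *ᴼ s *ᴼ (s *ᴼ s ⊟ ι (+ 2) *ᴼ s *ᴼ x +ᴼ ι (+ 4) *ᴼ f) ⊟ ι (+ 8) *ᴼ s *ᴼ m)
            (doubled b c d) ⟩
  s *ᴼ s *ᴼ (s *ᴼ s ⊟ ι (+ 2) *ᴼ s *ᴼ (ι (+ 2) *ᴼ e) +ᴼ ι (+ 4) *ᴼ f) ⊟ ι (+ 8) *ᴼ s *ᴼ m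
    ≡⟨ reduce k e f m ⟩
  ι 1ℤ +ᴼ ι (+ 4) *ᴼ ((f ⊟ e) +ᴼ ι (+ 2) *ᴼ remainder k e f m) ∎)
  where
  open ≡-Reasoning
  s p q r e f m : O
  s = ι 1ℤ +ᴼ ι (+ 2) *ᴼ k
  p = c +ᴼ d
  q = b +ᴼ d
  r = b +ᴼ c
  e = b +ᴼ c +ᴼ d
  f = p *ᴼ q +ᴼ p *ᴼ r +ᴼ q *ᴼ r
  m = p *ᴼ q *ᴼ r

  remainder : O → O → O → O → O
  remainder k e f m =
    k +ᴼ ι (+ 3) *ᴼ k *ᴼ k +ᴼ ι (+ 4) *ᴼ k *ᴼ k *ᴼ k +ᴼ ι (+ 2) *ᴼ k *ᴼ k *ᴼ k *ᴼ k
    ⊟ e *ᴼ k +ᴼ ι (+ 2) *ᴼ (k +ᴼ k *ᴼ k) *ᴼ (f ⊟ e *ᴼ (ι 1ℤ +ᴼ ι (+ 2) *ᴼ k))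
    ⊟ (ι 1ℤ +ᴼ ι (+ 2) *ᴼ k) *ᴼ m

  factor₁ : ∀ s b c d → ((s ⊟ (b +ᴼ c +ᴼ d)) +ᴼ b) +ᴼ (c +ᴼ d) ≡ s
  factor₁ = RingSolver.solve-∀ O-ring
  factor₂ : ∀ s b c d → ((s ⊟ (b +ᴼ c +ᴼ d)) +ᴼ b) ⊟ (c +ᴼ d) ≡ s ⊟ ι (+ 2) *ᴼ (c +ᴼ d)
  factor₂ = RingSolver.solve-∀ O-ring
  factor₃ : ∀ s b c d → ((s ⊟ (b +ᴼ c +ᴼ d)) ⊟ b) +ᴼ (c ⊟ d) ≡ s ⊟ ι (+ 2) *ᴼ (b +ᴼ d)
  factor₃ = RingSolver.solve-∀ O-ring
  factor₄ : ∀ s b c d → ((s ⊟ (b +ᴼ c +ᴼ d)) ⊟ b) ⊟ (c ⊟ d) ≡ s ⊟ ι (+ 2) *ᴼ (b +ᴼ c)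
  factor₄ = RingSolver.solve-∀ O-ring

  expand : ∀ s p q r →
    s *ᴼ (s ⊟ ι (+ 2) *ᴼ p) *ᴼ ((s ⊟ ι (+ 2) *ᴼ q) *ᴼ (s ⊟ ι (+ 2) *ᴼ r)) ≡
    s *ᴼ s *ᴼ (s *ᴼ s ⊟ ι (+ 2) *ᴼ s *ᴼ (p +ᴼ q +ᴼ r) +ᴼ ι (+ 4) *ᴼ (p *ᴼ q +ᴼ p *ᴼ r +ᴼ q *ᴼ r))
    ⊟ ι (+ 8) *ᴼ s *ᴼ (p *ᴼ q *ᴼ r)
  expand = RingSolver.solve-∀ O-ring

  doubled : ∀ b c d → (c +ᴼ d) +ᴼ (b +ᴼ d) +ᴼ (b +ᴼ c) ≡ ι (+ 2) *ᴼ (b +ᴼ c +ᴼ d)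
  doubled = RingSolver.solve-∀ O-ring

  reduce : ∀ k e f m → let s = ι 1ℤ +ᴼ ι (+ 2) *ᴼ k in
    s *ᴼ s *ᴼ (s *ᴼ s ⊟ ι (+ 2) *ᴼ s *ᴼ (ι (+ 2) *ᴼ e) +ᴼ ι (+ 4) *ᴼ f) ⊟ ι (+ 8) *ᴼ s *ᴼ m ≡
    ι 1ℤ +ᴼ ι (+ 4) *ᴼ ((f ⊟ e) +ᴼ ι (+ 2) *ᴼ (
      k +ᴼ ι (+ 3) *ᴼ k *ᴼ k +ᴼ ι (+ 4) *ᴼ k *ᴼ k *ᴼ k +ᴼ ι (+ 2) *ᴼ k *ᴼ k *ᴼ k *ᴼ k
      ⊟ e *ᴼ k +ᴼ ι (+ 2) *ᴼ (k +ᴼ k *ᴼ k) *ᴼ (f ⊟ e *ᴼ s) ⊟ s *ᴼ m))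
  reduce = RingSolver.solve-∀ O-ring

-- A polynomial with integer coefficients depends modulo 2 only on its arguments modulo 2. This
-- compares the sums p + q with the differences p - q = (p + q) - 2q.
quadric-mod2 : ∀ b c d b′ c′ d′ → ∃[ l ]
  quadric (b ⊟ ι (+ 2) *ᴼ b′) (c ⊟ ι (+ 2) *ᴼ c′) (d ⊟ ι (+ 2) *ᴼ d′) ≡
  quadric b c d +ᴼ ι (+ 2) *ᴼ l
quadric-mod2 b c d b′ c′ d′ = carry , expand b c d b′ c′ d′
  where
  carry : O
  carry =
    let p = c +ᴼ d
        q = b +ᴼ d
        r = b +ᴼ c
        p′ = c′ +ᴼ d′
        q′ = b′ +ᴼ d′
        r′ = b′ +ᴼ c′
    in
    ι (+ 2) *ᴼ (p′ *ᴼ q′ +ᴼ p′ *ᴼ r′ +ᴼ q′ *ᴼ r′) +ᴼ (b′ +ᴼ c′ +ᴼ d′)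
    ⊟ (p *ᴼ (q′ +ᴼ r′) +ᴼ q *ᴼ (p′ +ᴼ r′) +ᴼ r *ᴼ (p′ +ᴼ q′))

  expand : ∀ b c d b′ c′ d′ →
    let p = c +ᴼ d
        q = b +ᴼ d
        r = b +ᴼ c
        p′ = c′ +ᴼ d′
        q′ = b′ +ᴼ d′
        r′ = b′ +ᴼ c′
        y = b ⊟ ι (+ 2) *ᴼ b′
        z = c ⊟ ι (+ 2) *ᴼ c′
        w = d ⊟ ι (+ 2) *ᴼ d′
    in
    (z +ᴼ w) *ᴼ (y +ᴼ w) +ᴼ (z +ᴼ w) *ᴼ (y +ᴼ z) +ᴼ (y +ᴼ w) *ᴼ (y +ᴼ z) ⊟ (y +ᴼ z +ᴼ w) ≡
    (p *ᴼ q +ᴼ p *ᴼ r +ᴼ q *ᴼ r ⊟ (b +ᴼ c +ᴼ d)) +ᴼ ι (+ 2) *ᴼ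
      (ι (+ 2) *ᴼ (p′ *ᴼ q′ +ᴼ p′ *ᴼ r′ +ᴼ q′ *ᴼ r′) +ᴼ (b′ +ᴼ c′ +ᴼ d′)
       ⊟ (p *ᴼ (q′ +ᴼ r′) +ᴼ q *ᴼ (p′ +ᴼ r′) +ᴼ r *ᴼ (p′ +ᴼ q′)))
  expand = RingSolver.solve-∀ O-ring

≡1+8⇒≡1 : ∀ {x} y → x ≡ ι 1ℤ +ᴼ ι (+ 8) *ᴼ y → x -ᴼ ι 1ℤ ≡ ι (+ 8) *ᴼ y
≡1+8⇒≡1 y refl = cancel (ι (+ 8) *ᴼ y)
  where
  cancel : ∀ x → (ι 1ℤ +ᴼ x) ⊟ ι 1ℤ ≡ x
  cancel = RingSolver.solve-∀ O-ring

-- The two quartics are 1 + 4m and 1 + 4m′ with m and m′ congruent modulo 2, so 4(m + m′) and 16mm′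
-- are multiples of 8.
quartic-pair : ∀ k p₀ p₁ p₂ p₃ q₀ q₁ q₂ q₃ →
  ((p₀ +ᴼ q₀) +ᴼ (p₁ +ᴼ q₁)) +ᴼ ((p₂ +ᴼ q₂) +ᴼ (p₃ +ᴼ q₃)) ≡ ι 1ℤ +ᴼ ι (+ 2) *ᴼ k →
  quartic (p₀ +ᴼ q₀) (p₁ +ᴼ q₁) (p₂ +ᴼ q₂) (p₃ +ᴼ q₃) *ᴼ
  quartic (p₀ ⊟ q₀) (p₁ ⊟ q₁) (p₂ ⊟ q₂) (p₃ ⊟ q₃) ≡ᴼ ι 1ℤ [mod ι (+ 8) ]
quartic-pair k p₀ p₁ p₂ p₃ q₀ q₁ q₂ q₃ total =
  let h  , f⁺ = quartic-expansion k y₁ y₂ y₃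
      -- The differences sum to the total 1 + 2k of the sums less twice the sum of the `q`s, which
      -- is again 1 modulo 2.
      h′ , f⁻ = quartic-expansion (k ⊟ (q₀ +ᴼ q₁ +ᴼ q₂ +ᴼ q₃)) z₁ z₂ z₃
      l  , g⁻ = quadric-mod2 y₁ y₂ y₃ q₁ q₂ q₃
  in excess (quadric y₁ y₂ y₃) h l h′ , ≡1+8⇒≡1 (excess (quadric y₁ y₂ y₃) h l h′) (begin
  quartic (p₀ +ᴼ q₀) y₁ y₂ y₃ *ᴼ quartic (p₀ ⊟ q₀) z₁ z₂ z₃
    ≡⟨ cong₂ (λ a a′ → quartic a y₁ y₂ y₃ *ᴼ quartic a′ z₁ z₂ z₃)
         (trans (first⁺ p₀ p₁ p₂ p₃ q₀ q₁ q₂ q₃) (cong (_⊟ (y₁ +ᴼ y₂ +ᴼ y₃)) total))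
         (trans (first⁻ p₀ p₁ p₂ p₃ q₀ q₁ q₂ q₃)
                (trans (cong (λ s → s ⊟ ι (+ 2) *ᴼ (q₀ +ᴼ q₁ +ᴼ q₂ +ᴼ q₃) ⊟ (z₁ +ᴼ z₂ +ᴼ z₃)) total)
                       (shift k (q₀ +ᴼ q₁ +ᴼ q₂ +ᴼ q₃) (z₁ +ᴼ z₂ +ᴼ z₃)))) ⟩
  quartic (ι 1ℤ +ᴼ ι (+ 2) *ᴼ k ⊟ (y₁ +ᴼ y₂ +ᴼ y₃)) y₁ y₂ y₃ *ᴼ
  quartic (ι 1ℤ +ᴼ ι (+ 2) *ᴼ (k ⊟ (q₀ +ᴼ q₁ +ᴼ q₂ +ᴼ q₃)) ⊟ (z₁ +ᴼ z₂ +ᴼ z₃)) z₁ z₂ z₃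
    ≡⟨ cong₂ _*ᴼ_ f⁺ f⁻ ⟩
  (ι 1ℤ +ᴼ ι (+ 4) *ᴼ (quadric y₁ y₂ y₃ +ᴼ ι (+ 2) *ᴼ h)) *ᴼ
  (ι 1ℤ +ᴼ ι (+ 4) *ᴼ (quadric z₁ z₂ z₃ +ᴼ ι (+ 2) *ᴼ h′))
    ≡⟨ cong (λ x → (ι 1ℤ +ᴼ ι (+ 4) *ᴼ (quadric y₁ y₂ y₃ +ᴼ ι (+ 2) *ᴼ h)) *ᴼ
                   (ι 1ℤ +ᴼ ι (+ 4) *ᴼ (x +ᴼ ι (+ 2) *ᴼ h′))) (trans quadric-z g⁻) ⟩
  (ι 1ℤ +ᴼ ι (+ 4) *ᴼ (quadric y₁ y₂ y₃ +ᴼ ι (+ 2) *ᴼ h)) *ᴼ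
  (ι 1ℤ +ᴼ ι (+ 4) *ᴼ ((quadric y₁ y₂ y₃ +ᴼ ι (+ 2) *ᴼ l) +ᴼ ι (+ 2) *ᴼ h′))
    ≡⟨ multiply (quadric y₁ y₂ y₃) h l h′ ⟩
  ι 1ℤ +ᴼ ι (+ 8) *ᴼ excess (quadric y₁ y₂ y₃) h l h′ ∎)
  where
  open ≡-Reasoning
  y₁ y₂ y₃ z₁ z₂ z₃ : O
  y₁ = p₁ +ᴼ q₁
  y₂ = p₂ +ᴼ q₂
  y₃ = p₃ +ᴼ q₃
  z₁ = p₁ ⊟ q₁
  z₂ = p₂ ⊟ q₂
  z₃ = p₃ ⊟ q₃

  first⁺ : ∀ p₀ p₁ p₂ p₃ q₀ q₁ q₂ q₃ → p₀ +ᴼ q₀ ≡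
    ((p₀ +ᴼ q₀) +ᴼ (p₁ +ᴼ q₁)) +ᴼ ((p₂ +ᴼ q₂) +ᴼ (p₃ +ᴼ q₃)) ⊟
    ((p₁ +ᴼ q₁) +ᴼ (p₂ +ᴼ q₂) +ᴼ (p₃ +ᴼ q₃))
  first⁺ = RingSolver.solve-∀ O-ring

  first⁻ : ∀ p₀ p₁ p₂ p₃ q₀ q₁ q₂ q₃ → p₀ ⊟ q₀ ≡
    ((p₀ +ᴼ q₀) +ᴼ (p₁ +ᴼ q₁)) +ᴼ ((p₂ +ᴼ q₂) +ᴼ (p₃ +ᴼ q₃)) ⊟
    ι (+ 2) *ᴼ (q₀ +ᴼ q₁ +ᴼ q₂ +ᴼ q₃) ⊟ ((p₁ ⊟ q₁) +ᴼ (p₂ ⊟ q₂) +ᴼ (p₃ ⊟ q₃))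
  first⁻ = RingSolver.solve-∀ O-ring

  shift : ∀ k q z → ι 1ℤ +ᴼ ι (+ 2) *ᴼ k ⊟ ι (+ 2) *ᴼ q ⊟ z ≡ ι 1ℤ +ᴼ ι (+ 2) *ᴼ (k ⊟ q) ⊟ z
  shift = RingSolver.solve-∀ O-ring

  difference : ∀ p q → p ⊟ q ≡ (p +ᴼ q) ⊟ ι (+ 2) *ᴼ q
  difference = RingSolver.solve-∀ O-ring

  quadric-z : quadric z₁ z₂ z₃ ≡
    quadric (y₁ ⊟ ι (+ 2) *ᴼ q₁) (y₂ ⊟ ι (+ 2) *ᴼ q₂) (y₃ ⊟ ι (+ 2) *ᴼ q₃)
  quadric-z = cong₂ (λ a f → f a) (difference p₁ q₁)
    (cong₂ (λ b c a → quadric a b c) (difference p₂ q₂) (difference p₃ q₃))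

  excess : O → O → O → O → O
  excess g h l h′ = g +ᴼ h +ᴼ l +ᴼ h′ +ᴼ
    ι (+ 2) *ᴼ (g +ᴼ ι (+ 2) *ᴼ h) *ᴼ ((g +ᴼ ι (+ 2) *ᴼ l) +ᴼ ι (+ 2) *ᴼ h′)

  multiply : ∀ g h l h′ →
    (ι 1ℤ +ᴼ ι (+ 4) *ᴼ (g +ᴼ ι (+ 2) *ᴼ h)) *ᴼ
    (ι 1ℤ +ᴼ ι (+ 4) *ᴼ ((g +ᴼ ι (+ 2) *ᴼ l) +ᴼ ι (+ 2) *ᴼ h′)) ≡
    ι 1ℤ +ᴼ ι (+ 8) *ᴼ (g +ᴼ h +ᴼ l +ᴼ h′ +ᴼ
      ι (+ 2) *ᴼ (g +ᴼ ι (+ 2) *ᴼ h) *ᴼ ((g +ᴼ ι (+ 2) *ᴼ l) +ᴼ ι (+ 2) *ᴼ h′))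
  multiply = RingSolver.solve-∀ O-ring

-- The special element

-- Unapplied, since terms built from different instances of GroupRing G are compared by unfolding
-- them into sums over G.
open GroupRing using ()
  renaming (1# to 𝟙; ⟦_⟧ to _∋⟦_⟧; _+_ to _⟨_⊞_⟩; _*_ to _⟨_⊠_⟩; _·_ to _⟨_⊡_⟩)

-- The image of `e` under the inclusion of ℤ[H] in ℤ[C₂ × H]; both characters of C₂ send it back to
-- `e`.
extend : ∀ {X : Set} → (X → ℤ) → Fin 2 × X → ℤ
extend e (0₂ , x) = e x
extend e (1₂ , x) = 0ℤ

module _ (H : FiniteGroup) where
  groupDet-extend : ∀ (e : ℤ[G] H) → groupDet (cyclic 2 ×ᴳ H) (extend e) ≡ groupDet H e * groupDet H e
  groupDet-extend e = trans (groupDet-C₂× H (extend e))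
    (cong₂ _*_ (groupDet-cong H (extend e ⁺) e λ h → +-identityʳ (e h))
               (groupDet-cong H (extend e ⁻) e λ h → +-identityʳ (e h)))

  -- The second summand is (1 + u)c for the generator u of C₂: it becomes 2c at the trivial
  -- character and 0 at the other.
  groupDet-extend-+ : ∀ (e c : ℤ[G] H) →
    groupDet (cyclic 2 ×ᴳ H) (λ x → extend e x + c (proj₂ x)) ≡
    groupDet H (λ h → e h + (c h + c h)) * groupDet H e
  groupDet-extend-+ e c = trans (groupDet-C₂× H a)
    (cong₂ _*_ (groupDet-cong H (a ⁺) (λ h → e h + (c h + c h)) λ h → sum₂ (e h) (c h))
               (groupDet-cong H (a ⁻) e λ h → diff₂ (e h) (c h)))
    where
    a : ℤ[G] (cyclic 2 ×ᴳ H)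
    a x = extend e x + c (proj₂ x)

    sum₂ : ∀ e c → (e + c) + (0ℤ + c) ≡ e + (c + c)
    sum₂ = solve-∀
    diff₂ : ∀ e c → (e + c) - (0ℤ + c) ≡ e
    diff₂ = solve-∀

-- Three doublings turn `c` into 8c at the trivial character of C₂³. The other seven characters each
-- contribute the determinant of `e`, which is 1.
groupDet-extend³-+ : ∀ H (e c : ℤ[G] H) → groupDet H e ≡ 1ℤ →
  groupDet (cyclic 2 ×ᴳ cyclic 2 ×ᴳ cyclic 2 ×ᴳ H)
    (λ x → extend (extend (extend e)) x + c (proj₂ (proj₂ (proj₂ x)))) ≡
  groupDet H (λ h → e h + + 8 * c h)
groupDet-extend³-+ H e c det-e = begin
  groupDet (cyclic 2 ×ᴳ C₂²×H) (λ x → extend (extend (extend e)) x + c (proj₂ (proj₂ (proj₂ x))))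
    ≡⟨ groupDet-extend-+ C₂²×H (extend (extend e)) (c ∘ proj₂ ∘ proj₂) ⟩
  groupDet C₂²×H (λ x → extend (extend e) x + c₂ (proj₂ (proj₂ x))) * groupDet C₂²×H (extend (extend e))
    ≡⟨ cong₂ _*_ (groupDet-extend-+ C₂×H (extend e) (c₂ ∘ proj₂)) det-extend² ⟩
  groupDet C₂×H (λ x → extend e x + c₄ (proj₂ x)) * groupDet C₂×H (extend e) * 1ℤ
    ≡⟨ cong (_* 1ℤ) (cong₂ _*_ (groupDet-extend-+ H e c₄) det-extend) ⟩
  groupDet H (λ h → e h + (c₄ h + c₄ h)) * groupDet H e * 1ℤ * 1ℤ
    ≡⟨ cong (λ x → groupDet H (λ h → e h + (c₄ h + c₄ h)) * x * 1ℤ * 1ℤ) det-e ⟩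
  groupDet H (λ h → e h + (c₄ h + c₄ h)) * 1ℤ * 1ℤ * 1ℤ
    ≡⟨ units (groupDet H (λ h → e h + (c₄ h + c₄ h))) ⟩
  groupDet H (λ h → e h + (c₄ h + c₄ h))
    ≡⟨ groupDet-cong H (λ h → e h + (c₄ h + c₄ h)) (λ h → e h + + 8 * c h) (λ h → eightfold (e h) (c h)) ⟩
  groupDet H (λ h → e h + + 8 * c h) ∎
  where
  open ≡-Reasoning
  C₂×H C₂²×H : FiniteGroup
  C₂×H  = cyclic 2 ×ᴳ H
  C₂²×H = cyclic 2 ×ᴳ C₂×H

  c₂ c₄ : ℤ[G] H
  c₂ h = c h + c h
  c₄ h = c₂ h + c₂ h

  det-extend : groupDet C₂×H (extend e) ≡ 1ℤ
  det-extend = trans (groupDet-extend H e) (cong₂ _*_ det-e det-e)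

  det-extend² : groupDet C₂²×H (extend (extend e)) ≡ 1ℤ
  det-extend² = trans (groupDet-extend C₂×H (extend e)) (cong₂ _*_ det-extend det-extend)

  units : ∀ x → x * 1ℤ * 1ℤ * 1ℤ ≡ x
  units = solve-∀

  eightfold : ∀ e c → e + (((c + c) + (c + c)) + ((c + c) + (c + c))) ≡ e + + 8 * c
  eightfold = solve-∀

module _ (G : FiniteGroup) where
  open FiniteGroup G using (element; _∙_; _⁻¹)

  ⊠-congˡ : ∀ a {b c : ℤ[G] G} → (∀ g → b g ≡ c g) → ∀ g → (G ⟨ a ⊠ b ⟩) g ≡ (G ⟨ a ⊠ c ⟩) g
  ⊠-congˡ a b≡c g = sum-cong-≗ λ i → cong (a (element i) *_) (b≡c (element i ⁻¹ ∙ g))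

  ⊠-distribˡ-⊞ : ∀ (a b c : ℤ[G] G) g →
    (G ⟨ a ⊠ G ⟨ b ⊞ c ⟩ ⟩) g ≡ (G ⟨ a ⊠ b ⟩) g + (G ⟨ a ⊠ c ⟩) g
  ⊠-distribˡ-⊞ a b c g = trans
    (sum-cong-≗ λ i → *-distribˡ-+ (a (element i)) (b (element i ⁻¹ ∙ g)) (c (element i ⁻¹ ∙ g)))
    (∑-distrib-+ (λ i → a (element i) * b (element i ⁻¹ ∙ g)) (λ i → a (element i) * c (element i ⁻¹ ∙ g)))

  ⊠-⊡ : ∀ (a : ℤ[G] G) k b g → (G ⟨ a ⊠ G ⟨ k ⊡ b ⟩ ⟩) g ≡ k * (G ⟨ a ⊠ b ⟩) g
  ⊠-⊡ a k b g = trans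
    (sum-cong-≗ λ i → commute (a (element i)) k (b (element i ⁻¹ ∙ g)))
    (sym (*-distribˡ-sum k (λ i → a (element i) * b (element i ⁻¹ ∙ g))))
    where
    commute : ∀ x k y → x * (k * y) ≡ k * (x * y)
    commute = solve-∀

  -- Pulls the variables `r`, `s`, `t` out of the product, leaving products of closed elements that
  -- can be checked by evaluation.
  ⊠-linear : ∀ {a b₀ b₁ b₂ c₀ c₁ c₂ : ℤ[G] G} r s t →
    (∀ g → (G ⟨ a ⊠ b₀ ⟩) g ≡ c₀ g) → (∀ g → (G ⟨ a ⊠ b₁ ⟩) g ≡ c₁ g) → (∀ g → (G ⟨ a ⊠ b₂ ⟩) g ≡ c₂ g) →
    ∀ g → (G ⟨ a ⊠ G ⟨ G ⟨ G ⟨ r ⊡ b₀ ⟩ ⊞ G ⟨ s ⊡ b₁ ⟩ ⟩ ⊞ G ⟨ t ⊡ b₂ ⟩ ⟩ ⟩) g ≡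
      r * c₀ g + s * c₁ g + t * c₂ g
  ⊠-linear {a} {b₀} {b₁} {b₂} {c₀} {c₁} {c₂} r s t ab₀ ab₁ ab₂ g = trans
    (⊠-distribˡ-⊞ a (G ⟨ G ⟨ r ⊡ b₀ ⟩ ⊞ G ⟨ s ⊡ b₁ ⟩ ⟩) (G ⟨ t ⊡ b₂ ⟩) g)
    (cong₂ _+_ (trans (⊠-distribˡ-⊞ a (G ⟨ r ⊡ b₀ ⟩) (G ⟨ s ⊡ b₁ ⟩) g)
                      (cong₂ _+_ (scaled r b₀ c₀ ab₀) (scaled s b₁ c₁ ab₁)))
               (scaled t b₂ c₂ ab₂))
    where
    scaled : ∀ k b c → (∀ g → (G ⟨ a ⊠ b ⟩) g ≡ c g) → (G ⟨ a ⊠ G ⟨ k ⊡ b ⟩ ⟩) g ≡ k * c g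
    scaled k b c ab = trans (⊠-⊡ a k b g) (cong (k *_) (ab g))

δ : Fin 3 → Fin 3 → ℤ
δ zero             zero             = 1ℤ
δ (suc zero)       (suc zero)       = 1ℤ
δ (suc (suc zero)) (suc (suc zero)) = 1ℤ
δ _                _                = 0ℤ

-- This is (1 + u)(1 + v)(1 + w)(c₀ + c₁z + c₂z²); in particular `lift (δ zero)` is (1 + u)(1 + v)(1
-- + w).
lift : (Fin 3 → ℤ) → ℤ[G] C₂³×C₃
lift c (_ , _ , _ , l) = c l

infix 4 _≐?_
_≐?_ : ∀ (a b : ℤ[G] C₂³×C₃) → _
a ≐? b = Fin.all? λ i → Fin.all? λ j → Fin.all? λ k → Fin.all? λ l → a (i , j , k , l) ≟ b (i , j , k , l)

Z : ℤ[G] C₂³×C₃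
Z = C₂³×C₃ ∋⟦ Generators.z ⟧

z² : FiniteGroup.Carrier C₂³×C₃
z² = zero , zero , zero , suc (suc zero)

lift-δ₀-⊠-𝟙 : ∀ g → (C₂³×C₃ ⟨ lift (δ zero) ⊠ 𝟙 C₂³×C₃ ⟩) g ≡ lift (δ zero) g
lift-δ₀-⊠-𝟙 (i , j , k , l) =
  from-yes (C₂³×C₃ ⟨ lift (δ zero) ⊠ 𝟙 C₂³×C₃ ⟩ ≐? lift (δ zero)) i j k l

lift-δ₀-⊠-Z : ∀ g → (C₂³×C₃ ⟨ lift (δ zero) ⊠ Z ⟩) g ≡ lift (δ (suc zero)) g
lift-δ₀-⊠-Z (i , j , k , l) =
  from-yes (C₂³×C₃ ⟨ lift (δ zero) ⊠ Z ⟩ ≐? lift (δ (suc zero))) i j k l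

-- Replaces the product by a single group element, so that the check of `lift-δ₀-⊠-z²` does not nest
-- one sum over the group in another.
Z⊠Z : ∀ g → (C₂³×C₃ ⟨ Z ⊠ Z ⟩) g ≡ (C₂³×C₃ ∋⟦ z² ⟧) g
Z⊠Z (i , j , k , l) = from-yes (C₂³×C₃ ⟨ Z ⊠ Z ⟩ ≐? (C₂³×C₃ ∋⟦ z² ⟧)) i j k l

lift-δ₀-⊠-z² : ∀ g → (C₂³×C₃ ⟨ lift (δ zero) ⊠ C₂³×C₃ ∋⟦ z² ⟧ ⟩) g ≡ lift (δ (suc (suc zero))) g
lift-δ₀-⊠-z² (i , j , k , l) =
  from-yes (C₂³×C₃ ⟨ lift (δ zero) ⊠ C₂³×C₃ ∋⟦ z² ⟧ ⟩ ≐? lift (δ (suc (suc zero)))) i j k l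

𝟙-extend : ∀ g → 𝟙 C₂³×C₃ g ≡ extend (extend (extend (δ zero))) g
𝟙-extend (i , j , k , l) = from-yes (𝟙 C₂³×C₃ ≐? extend (extend (extend (δ zero)))) i j k l

coefficients : ℤ → ℤ → ℤ → Fin 3 → ℤ
coefficients r s t zero             = r
coefficients r s t (suc zero)       = s
coefficients r s t (suc (suc zero)) = t

coefficients-δ : ∀ r s t l →
  r * δ zero l + s * δ (suc zero) l + t * δ (suc (suc zero)) l ≡ coefficients r s t l
coefficients-δ r s t zero = lemma r s t
  where
  lemma : ∀ r s t → r * 1ℤ + s * 0ℤ + t * 0ℤ ≡ r
  lemma = solve-∀
coefficients-δ r s t (suc zero) = lemma r s t
  where
  lemma : ∀ r s t → r * 0ℤ + s * 1ℤ + t * 0ℤ ≡ s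
  lemma = solve-∀
coefficients-δ r s t (suc (suc zero)) = lemma r s t
  where
  lemma : ∀ r s t → r * 0ℤ + s * 0ℤ + t * 1ℤ ≡ t
  lemma = solve-∀

-- (1 + u)(1 + v)(1 + w) is evaluated to its coefficient function by conversion checking.
specialElement-normalised : ∀ r s t g → specialElement r s t g ≡
  (C₂³×C₃ ⟨ 𝟙 C₂³×C₃ ⊞ C₂³×C₃ ⟨ lift (δ zero) ⊠
    C₂³×C₃ ⟨ C₂³×C₃ ⟨ C₂³×C₃ ⟨ r ⊡ 𝟙 C₂³×C₃ ⟩ ⊞ C₂³×C₃ ⟨ s ⊡ Z ⟩ ⟩ ⊞ C₂³×C₃ ⟨ t ⊡ C₂³×C₃ ⟨ Z ⊠ Z ⟩ ⟩ ⟩ ⟩ ⟩) g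
specialElement-normalised r s t g = refl

specialElement-coefficients : ∀ r s t g →
  specialElement r s t g ≡ extend (extend (extend (δ zero))) g + lift (coefficients r s t) g
specialElement-coefficients r s t g@(_ , _ , _ , l) =
  trans (specialElement-normalised r s t g)
        (cong₂ _+_ (𝟙-extend g)
          (trans (⊠-linear C₂³×C₃ {lift (δ zero)} {𝟙 C₂³×C₃} {Z} {C₂³×C₃ ⟨ Z ⊠ Z ⟩}
                   {lift (δ zero)} {lift (δ (suc zero))} {lift (δ (suc (suc zero)))} r s t
                   lift-δ₀-⊠-𝟙 lift-δ₀-⊠-Z lift-δ₀-⊠-Z² g)
                 (coefficients-δ r s t l)))
  where
  lift-δ₀-⊠-Z² : ∀ g → (C₂³×C₃ ⟨ lift (δ zero) ⊠ C₂³×C₃ ⟨ Z ⊠ Z ⟩ ⟩) g ≡ lift (δ (suc (suc zero))) g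
  lift-δ₀-⊠-Z² g = trans
    (⊠-congˡ C₂³×C₃ (lift (δ zero)) {C₂³×C₃ ⟨ Z ⊠ Z ⟩} {C₂³×C₃ ∋⟦ z² ⟧} Z⊠Z g) (lift-δ₀-⊠-z² g)

determinant-specialElement : ∀ r s t →
  determinant C₂³×C₃ (specialElement r s t) ≡
  (1ℤ + + 8 * (r + s + t)) * N ((1ℤ + + 8 * (r - t)) +ω (+ 8 * (s - t)))
determinant-specialElement r s t = begin
  determinant C₂³×C₃ (specialElement r s t)
    ≡⟨ determinant≡groupDet C₂³×C₃ (specialElement r s t) ⟩
  groupDet C₂³×C₃ (specialElement r s t)
    ≡⟨ groupDet-cong C₂³×C₃ (specialElement r s t)
         (λ g → extend (extend (extend (δ zero))) g + lift (coefficients r s t) g)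
         (specialElement-coefficients r s t) ⟩
  groupDet C₂³×C₃ (λ g → extend (extend (extend (δ zero))) g + lift (coefficients r s t) g)
    -- The formula for C₃ at the identity element computes to 1, which supplies the hypothesis on
    -- `δ zero`.
    ≡⟨ groupDet-extend³-+ (cyclic 3) (δ zero) (coefficients r s t) (groupDet-C₃ (δ zero)) ⟩
  groupDet (cyclic 3) b
    ≡⟨ groupDet-C₃ b ⟩
  σ b * N (atω b)
    ≡⟨ cong₂ _*_ (σ-b r s t) (cong N (cong₂ _+ω_ (coefficient₁ r t) (coefficientω s t))) ⟩
  (1ℤ + + 8 * (r + s + t)) * N ((1ℤ + + 8 * (r - t)) +ω (+ 8 * (s - t))) ∎
  where
  open ≡-Reasoning
  b : Fin 3 → ℤ
  b l = δ zero l + + 8 * coefficients r s t l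

  σ-b : ∀ r s t → (1ℤ + + 8 * r) + (0ℤ + + 8 * s) + (0ℤ + + 8 * t) ≡ 1ℤ + + 8 * (r + s + t)
  σ-b = solve-∀
  coefficient₁ : ∀ r t → (1ℤ + + 8 * r) - (0ℤ + + 8 * t) ≡ 1ℤ + + 8 * (r - t)
  coefficient₁ = solve-∀
  coefficientω : ∀ s t → (0ℤ + + 8 * s) - (0ℤ + + 8 * t) ≡ + 8 * (s - t)
  coefficientω = solve-∀

-- Products over the characters of C₂³

-- The product over the two characters of C₂. The multiplication is a parameter so that the same
-- product is available in ℤ, in `O` and in pairs from both.
∏± : ∀ {X R : Set} → (R → R → R) → ((X → ℤ) → R) → (Fin 2 × X → ℤ) → R
∏± _∙_ f a = f (a ⁺) ∙ f (a ⁻)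

∏±³ : ∀ {X R : Set} → (R → R → R) → ((X → ℤ) → R) → (Fin 2 × Fin 2 × Fin 2 × X → ℤ) → R
∏±³ _∙_ f = ∏± _∙_ (∏± _∙_ (∏± _∙_ f))

module _ {R S : Set} {_∙_ : R → R → R} {_∘′_ : S → S → S} (_∼_ : R → S → Set)
  (∙-∘ : ∀ {x y x′ y′} → x ∼ y → x′ ∼ y′ → (x ∙ x′) ∼ (y ∘′ y′)) where

  ∏±-rel : ∀ {X : Set} {f : (X → ℤ) → R} {g : (X → ℤ) → S} → (∀ b → f b ∼ g b) →
    ∀ a → ∏± _∙_ f a ∼ ∏± _∘′_ g a
  ∏±-rel f∼g a = ∙-∘ (f∼g (a ⁺)) (f∼g (a ⁻))

  -- A relation compatible with both multiplications passes from the eight factors to the products.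
  -- It is used for the homomorphism `ι` and for `Factors`.
  ∏±³-rel : ∀ {X : Set} {f : (X → ℤ) → R} {g : (X → ℤ) → S} → (∀ b → f b ∼ g b) →
    ∀ a → ∏±³ _∙_ f a ∼ ∏±³ _∘′_ g a
  ∏±³-rel f∼g = ∏±-rel (∏±-rel (∏±-rel f∼g))

groupDet-C₂³× : ∀ H {f} → (∀ b → groupDet H b ≡ f b) →
  ∀ a → groupDet (cyclic 2 ×ᴳ cyclic 2 ×ᴳ cyclic 2 ×ᴳ H) a ≡ ∏±³ _*_ f a
groupDet-C₂³× H det≡f = step (cyclic 2 ×ᴳ cyclic 2 ×ᴳ H) (step (cyclic 2 ×ᴳ H) (step H det≡f))
  where
  step : ∀ H {f} → (∀ b → groupDet H b ≡ f b) → ∀ a → groupDet (cyclic 2 ×ᴳ H) a ≡ ∏± _*_ f a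
  step H det≡f a = trans (groupDet-C₂× H a) (cong₂ _*_ (det≡f (a ⁺)) (det≡f (a ⁻)))

determinant-C₂³×C₃ : ∀ a → determinant C₂³×C₃ a ≡ ∏±³ _*_ (λ b → σ b * N (atω b)) a
determinant-C₂³×C₃ a = trans (determinant≡groupDet C₂³×C₃ a) (groupDet-C₂³× (cyclic 3) groupDet-C₃ a)

module _ {X : Set} (φ : (X → ℤ) → O)
  (φ-+ : ∀ b c → φ (λ x → b x + c x) ≡ φ b +ᴼ φ c)
  (φ-- : ∀ b c → φ (λ x → b x - c x) ≡ φ b ⊟ φ c) where

  ∏±∏±≡quartic : ∀ (a : Fin 2 × Fin 2 × X → ℤ) → ∏± _*ᴼ_ (∏± _*ᴼ_ φ) a ≡
    quartic (φ λ x → a (0₂ , 0₂ , x)) (φ λ x → a (1₂ , 0₂ , x))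
            (φ λ x → a (0₂ , 1₂ , x)) (φ λ x → a (1₂ , 1₂ , x))
  ∏±∏±≡quartic a = cong₂ _*ᴼ_
    (cong₂ _*ᴼ_
      (trans (φ-+ (a₀ ⁺) (a₁ ⁺)) (cong₂ _+ᴼ_ (φ-+ a₀₀ a₁₀) (φ-+ a₀₁ a₁₁)))
      (trans (φ-- (a₀ ⁺) (a₁ ⁺)) (cong₂ _⊟_  (φ-+ a₀₀ a₁₀) (φ-+ a₀₁ a₁₁))))
    (cong₂ _*ᴼ_
      (trans (φ-+ (a₀ ⁻) (a₁ ⁻)) (cong₂ _+ᴼ_ (φ-- a₀₀ a₁₀) (φ-- a₀₁ a₁₁)))
      (trans (φ-- (a₀ ⁻) (a₁ ⁻)) (cong₂ _⊟_  (φ-- a₀₀ a₁₀) (φ-- a₀₁ a₁₁))))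
    where
    a₀ a₁ : Fin 2 × X → ℤ
    a₀ (i , x) = a (i , 0₂ , x)
    a₁ (i , x) = a (i , 1₂ , x)
    a₀₀ a₁₀ a₀₁ a₁₁ : X → ℤ
    a₀₀ x = a (0₂ , 0₂ , x)
    a₁₀ x = a (1₂ , 0₂ , x)
    a₀₁ x = a (0₂ , 1₂ , x)
    a₁₁ x = a (1₂ , 1₂ , x)

  -- By additivity everything is expressed in the values `p` and `q` of `φ` on the eight slices of
  -- `a`. The characters trivial on the first generator see the sums p + q, the others the
  -- differences p - q, so `quartic-pair` applies.
  ∏±³≡1[mod8] : ∀ k a → φ (a ⁺ ⁺ ⁺) ≡ ι 1ℤ +ᴼ ι (+ 2) *ᴼ k → ∏±³ _*ᴼ_ φ a ≡ᴼ ι 1ℤ [mod ι (+ 8) ]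
  ∏±³≡1[mod8] k a total = subst (_≡ᴼ ι 1ℤ [mod ι (+ 8) ]) (sym product≡)
    (quartic-pair k (p 0₂ 0₂) (p 1₂ 0₂) (p 0₂ 1₂) (p 1₂ 1₂) (q 0₂ 0₂) (q 1₂ 0₂) (q 0₂ 1₂) (q 1₂ 1₂)
      (trans (sym total≡) total))
    where
    slice : Fin 2 → Fin 2 → Fin 2 → X → ℤ
    slice i j k x = a (i , j , k , x)

    p q : Fin 2 → Fin 2 → O
    p j k = φ (slice 0₂ j k)
    q j k = φ (slice 1₂ j k)

    φ⁺ : ∀ j k → φ (λ x → (a ⁺) (j , k , x)) ≡ p j k +ᴼ q j k
    φ⁺ j k = φ-+ (slice 0₂ j k) (slice 1₂ j k)
    φ⁻ : ∀ j k → φ (λ x → (a ⁻) (j , k , x)) ≡ p j k ⊟ q j k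
    φ⁻ j k = φ-- (slice 0₂ j k) (slice 1₂ j k)

    quartic-cong : ∀ {a a′ b b′ c c′ d d′} → a ≡ a′ → b ≡ b′ → c ≡ c′ → d ≡ d′ →
      quartic a b c d ≡ quartic a′ b′ c′ d′
    quartic-cong refl refl refl refl = refl

    product≡ : ∏±³ _*ᴼ_ φ a ≡
      quartic (p 0₂ 0₂ +ᴼ q 0₂ 0₂) (p 1₂ 0₂ +ᴼ q 1₂ 0₂) (p 0₂ 1₂ +ᴼ q 0₂ 1₂) (p 1₂ 1₂ +ᴼ q 1₂ 1₂) *ᴼ
      quartic (p 0₂ 0₂ ⊟ q 0₂ 0₂) (p 1₂ 0₂ ⊟ q 1₂ 0₂) (p 0₂ 1₂ ⊟ q 0₂ 1₂) (p 1₂ 1₂ ⊟ q 1₂ 1₂)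
    product≡ = cong₂ _*ᴼ_
      (trans (∏±∏±≡quartic (a ⁺)) (quartic-cong (φ⁺ 0₂ 0₂) (φ⁺ 1₂ 0₂) (φ⁺ 0₂ 1₂) (φ⁺ 1₂ 1₂)))
      (trans (∏±∏±≡quartic (a ⁻)) (quartic-cong (φ⁻ 0₂ 0₂) (φ⁻ 1₂ 0₂) (φ⁻ 0₂ 1₂) (φ⁻ 1₂ 1₂)))

    total≡ : φ (a ⁺ ⁺ ⁺) ≡
      ((p 0₂ 0₂ +ᴼ q 0₂ 0₂) +ᴼ (p 1₂ 0₂ +ᴼ q 1₂ 0₂)) +ᴼ ((p 0₂ 1₂ +ᴼ q 0₂ 1₂) +ᴼ (p 1₂ 1₂ +ᴼ q 1₂ 1₂))
    total≡ = trans (φ-+ (λ x → (a ⁺ ⁺) (0₂ , x)) (λ x → (a ⁺ ⁺) (1₂ , x)))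
      (cong₂ _+ᴼ_
        (trans (φ-+ (λ x → (a ⁺) (0₂ , 0₂ , x)) (λ x → (a ⁺) (1₂ , 0₂ , x))) (cong₂ _+ᴼ_ (φ⁺ 0₂ 0₂) (φ⁺ 1₂ 0₂)))
        (trans (φ-+ (λ x → (a ⁺) (0₂ , 1₂ , x)) (λ x → (a ⁺) (1₂ , 1₂ , x))) (cong₂ _+ᴼ_ (φ⁺ 0₂ 1₂) (φ⁺ 1₂ 1₂))))

-- The factors A and β

parity : ∀ x → ∃[ k ] (x ≡ + 2 * k ⊎ x ≡ 1ℤ + + 2 * k)
parity x with x %ℕ 2 | n%ℕd<d x 2 | a≡a%ℕn+[a/ℕn]*n x 2
... | 0 | _ | x≡ = x /ℕ 2 , inj₁ (trans x≡ (trans (+-identityˡ _) (*-comm (x /ℕ 2) (+ 2))))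
... | 1 | _ | x≡ = x /ℕ 2 , inj₂ (trans x≡ (cong (_+_ 1ℤ) (*-comm (x /ℕ 2) (+ 2))))
... | ℕ.suc (ℕ.suc _) | s≤s (s≤s ()) | _

odd⇒1+2k : ∀ {x} → Odd x → ∃[ k ] x ≡ 1ℤ + + 2 * k
odd⇒1+2k {x} odd with parity x
... | k , inj₁ x≡2k  = contradiction (divides k (trans x≡2k (*-comm (+ 2) k))) odd
... | k , inj₂ x≡1+2k = k , x≡1+2k

odd-*ˡ : ∀ x y → Odd (x * y) → Odd x
odd-*ˡ x y odd 2∣x = odd (∣m⇒∣m*n y 2∣x)

odd-*ʳ : ∀ x y → Odd (x * y) → Odd y
odd-*ʳ x y odd 2∣y = odd (∣n⇒∣m*n x 2∣y)

N-*ᴼ : ∀ x y → N (x *ᴼ y) ≡ N x * N y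
N-*ᴼ (a +ω b) (c +ω d) = lemma a b c d
  where
  lemma : ∀ a b c d → let x = a * c - b * d; y = a * d + b * c - b * d in
    x * x - x * y + y * y ≡ (a * a - a * b + b * b) * (c * c - c * d + d * d)
  lemma = solve-∀

-- The invertible residues modulo 2 are 1, ω and ω².
normalising-unit : ∀ x → Odd (N x) → ∃[ η ] ∃[ κ ] ∃[ k ]
  (N η ≡ 1ℤ × η ≡ ι 1ℤ +ᴼ λᴼ *ᴼ κ × η *ᴼ x ≡ ι 1ℤ +ᴼ ι (+ 2) *ᴼ k)
normalising-unit (b +ω c) odd with parity b | parity c
... | i , inj₁ refl | j , inj₁ refl =
  contradiction (divides (+ 2 * (i * i - i * j + j * j)) (even i j)) odd
  where
  even : ∀ i j → + 2 * i * (+ 2 * i) - + 2 * i * (+ 2 * j) + + 2 * j * (+ 2 * j) ≡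
    + 2 * (i * i - i * j + j * j) * + 2
  even = solve-∀
... | i , inj₂ refl | j , inj₁ refl =
  ι 1ℤ , ι 0ℤ , (i +ω j) , refl , refl , cong₂ _+ω_ (l₁ i j) (l₂ i j)
  where
  l₁ : ∀ i j → 1ℤ * (1ℤ + + 2 * i) - 0ℤ * (+ 2 * j) ≡ 1ℤ + (+ 2 * i - 0ℤ * j)
  l₁ = solve-∀
  l₂ : ∀ i j → 1ℤ * (+ 2 * j) + 0ℤ * (1ℤ + + 2 * i) - 0ℤ * (+ 2 * j) ≡
    0ℤ + (+ 2 * j + 0ℤ * i - 0ℤ * j)
  l₂ = solve-∀
... | i , inj₁ refl | j , inj₂ refl =
  -- The residue is ω, so η = ω² = -1 - ω; and 1 + λω² = ω², so κ is ω² too.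
  (-1ℤ +ω -1ℤ) , (-1ℤ +ω -1ℤ) , ((j - i) +ω (- i)) , refl , refl , cong₂ _+ω_ (l₁ i j) (l₂ i j)
  where
  l₁ : ∀ i j → -1ℤ * (+ 2 * i) - -1ℤ * (1ℤ + + 2 * j) ≡ 1ℤ + (+ 2 * (j - i) - 0ℤ * (- i))
  l₁ = solve-∀
  l₂ : ∀ i j → -1ℤ * (1ℤ + + 2 * j) + -1ℤ * (+ 2 * i) - -1ℤ * (1ℤ + + 2 * j) ≡
    0ℤ + (+ 2 * (- i) + 0ℤ * (j - i) - 0ℤ * (- i))
  l₂ = solve-∀
... | i , inj₂ refl | j , inj₂ refl =
  ω , ι -1ℤ , ((-1ℤ - j) +ω (i - j)) , refl , refl , cong₂ _+ω_ (l₁ i j) (l₂ i j)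
  where
  l₁ : ∀ i j → 0ℤ * (1ℤ + + 2 * i) - 1ℤ * (1ℤ + + 2 * j) ≡ 1ℤ + (+ 2 * (-1ℤ - j) - 0ℤ * (i - j))
  l₁ = solve-∀
  l₂ : ∀ i j → 0ℤ * (1ℤ + + 2 * j) + 1ℤ * (1ℤ + + 2 * i) - 1ℤ * (1ℤ + + 2 * j) ≡
    0ℤ + (+ 2 * (i - j) + 0ℤ * (-1ℤ - j) - 0ℤ * (i - j))
  l₂ = solve-∀

*ᴼ-distribˡ-⊟ : ∀ x y z → x *ᴼ (y ⊟ z) ≡ x *ᴼ y ⊟ x *ᴼ z
*ᴼ-distribˡ-⊟ = RingSolver.solve-∀ O-ring

atω-+ : ∀ b c → atω (λ l → b l + c l) ≡ atω b +ᴼ atω c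
atω-+ b c = cong₂ _+ω_ (lemma (b zero) (b (suc (suc zero))) (c zero) (c (suc (suc zero))))
                       (lemma (b (suc zero)) (b (suc (suc zero))) (c (suc zero)) (c (suc (suc zero))))
  where
  lemma : ∀ x z x′ z′ → x + x′ - (z + z′) ≡ (x - z) + (x′ - z′)
  lemma = solve-∀

atω-- : ∀ b c → atω (λ l → b l - c l) ≡ atω b ⊟ atω c
atω-- b c = cong₂ _+ω_ (lemma (b zero) (b (suc (suc zero))) (c zero) (c (suc (suc zero))))
                       (lemma (b (suc zero)) (b (suc (suc zero))) (c (suc zero)) (c (suc (suc zero))))
  where
  lemma : ∀ x z x′ z′ → x - x′ - (z - z′) ≡ (x - z) - (x′ - z′)
  lemma = solve-∀

σ-+ : ∀ b c → σ (λ l → b l + c l) ≡ σ b + σ c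
σ-+ b c = lemma (b zero) (b (suc zero)) (b (suc (suc zero))) (c zero) (c (suc zero)) (c (suc (suc zero)))
  where
  lemma : ∀ x y z x′ y′ z′ → x + x′ + (y + y′) + (z + z′) ≡ (x + y + z) + (x′ + y′ + z′)
  lemma = solve-∀

σ-- : ∀ b c → σ (λ l → b l - c l) ≡ σ b - σ c
σ-- b c = lemma (b zero) (b (suc zero)) (b (suc (suc zero))) (c zero) (c (suc zero)) (c (suc (suc zero)))
  where
  lemma : ∀ x y z x′ y′ z′ → x - x′ + (y - y′) + (z - z′) ≡ (x + y + z) - (x′ + y′ + z′)
  lemma = solve-∀

ι-* : ∀ x y → ι (x * y) ≡ ι x *ᴼ ι y
ι-* x y = cong₂ _+ω_ (l₁ x y) (l₂ x y)
  where
  l₁ : ∀ x y → x * y ≡ x * y - 0ℤ * 0ℤ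
  l₁ = solve-∀
  l₂ : ∀ x y → 0ℤ ≡ x * 0ℤ + 0ℤ * y - 0ℤ * 0ℤ
  l₂ = solve-∀

-- The difference is (1 - ω)y + (1 - ω²)z = λ(y + (1 + ω)z).
σ≡atω[modλ] : ∀ b → ι (σ b) ≡ᴼ atω b [mod λᴼ ]
σ≡atω[modλ] b = (y + z +ω z) , cong₂ _+ω_ (l₁ x y z) (l₂ y z)
  where
  x y z : ℤ
  x = b zero
  y = b (suc zero)
  z = b (suc (suc zero))
  l₁ : ∀ x y z → x + y + z - (x - z) ≡ 1ℤ * (y + z) - -1ℤ * z
  l₁ = solve-∀
  l₂ : ∀ y z → 0ℤ - (y - z) ≡ 1ℤ * z + -1ℤ * (y + z) - -1ℤ * z
  l₂ = solve-∀

≡[modλ]-*ᴼ : ∀ {a b c d} → a ≡ᴼ b [mod λᴼ ] → c ≡ᴼ d [mod λᴼ ] → a *ᴼ c ≡ᴼ b *ᴼ d [mod λᴼ ]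
≡[modλ]-*ᴼ {a} {b} {c} {d} (γ , a-b) (γ′ , c-d) = (γ *ᴼ c +ᴼ b *ᴼ γ′) , (begin
  a *ᴼ c ⊟ b *ᴼ d                       ≡⟨ split a b c d ⟩
  (a ⊟ b) *ᴼ c +ᴼ b *ᴼ (c ⊟ d)          ≡⟨ cong₂ (λ x y → x *ᴼ c +ᴼ b *ᴼ y) a-b c-d ⟩
  λᴼ *ᴼ γ *ᴼ c +ᴼ b *ᴼ (λᴼ *ᴼ γ′)       ≡⟨ collect λᴼ γ c b γ′ ⟩
  λᴼ *ᴼ (γ *ᴼ c +ᴼ b *ᴼ γ′)             ∎)
  where
  open ≡-Reasoning
  split : ∀ a b c d → a *ᴼ c ⊟ b *ᴼ d ≡ (a ⊟ b) *ᴼ c +ᴼ b *ᴼ (c ⊟ d)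
  split = RingSolver.solve-∀ O-ring
  collect : ∀ l γ c b γ′ → l *ᴼ γ *ᴼ c +ᴼ b *ᴼ (l *ᴼ γ′) ≡ l *ᴼ (γ *ᴼ c +ᴼ b *ᴼ γ′)
  collect = RingSolver.solve-∀ O-ring

≡[modλ]-unit : ∀ {x y} κ → x ≡ᴼ y [mod λᴼ ] → x ≡ᴼ (ι 1ℤ +ᴼ λᴼ *ᴼ κ) *ᴼ y [mod λᴼ ]
≡[modλ]-unit {x} {y} κ (γ , x-y) = (γ ⊟ κ *ᴼ y) ,
  trans (split x y λᴼ κ) (trans (cong (_⊟ λᴼ *ᴼ κ *ᴼ y) x-y) (collect λᴼ γ κ y))
  where
  split : ∀ x y l κ → x ⊟ (ι 1ℤ +ᴼ l *ᴼ κ) *ᴼ y ≡ (x ⊟ y) ⊟ l *ᴼ κ *ᴼ y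
  split = RingSolver.solve-∀ O-ring
  collect : ∀ l γ κ y → l *ᴼ γ ⊟ l *ᴼ κ *ᴼ y ≡ l *ᴼ (γ ⊟ κ *ᴼ y)
  collect = RingSolver.solve-∀ O-ring

≡1[mod8]⇒1+8 : ∀ x → x ≡ᴼ ι 1ℤ [mod ι (+ 8) ] → ∃[ g ] ∃[ h ] x ≡ (1ℤ + + 8 * g) +ω (+ 8 * h)
≡1[mod8]⇒1+8 (b +ω c) (g +ω h , eq) = g , h , cong₂ _+ω_
  (trans (l₁ b) (trans (cong (λ y → 1ℤ + O.coeff₁ y) eq) (l₂ g h)))
  (trans (l₃ c) (trans (cong O.coeffω eq) (l₄ g h)))
  where
  l₁ : ∀ b → b ≡ 1ℤ + (b - 1ℤ)
  l₁ = solve-∀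
  l₂ : ∀ g h → 1ℤ + (+ 8 * g - 0ℤ * h) ≡ 1ℤ + + 8 * g
  l₂ = solve-∀
  l₃ : ∀ c → c ≡ c - 0ℤ
  l₃ = solve-∀
  l₄ : ∀ g h → + 8 * h + 0ℤ * g - 0ℤ * h ≡ + 8 * h
  l₄ = solve-∀

N-1+8 : ∀ g h → ∃[ n ] N ((1ℤ + + 8 * g) +ω (+ 8 * h)) ≡ 1ℤ + + 8 * n
N-1+8 g h = (+ 2 * g + + 8 * g * g - h - + 8 * g * h + + 8 * h * h) , lemma g h
  where
  lemma : ∀ g h → (1ℤ + + 8 * g) * (1ℤ + + 8 * g) - (1ℤ + + 8 * g) * (+ 8 * h) + + 8 * h * (+ 8 * h)
    ≡ 1ℤ + + 8 * (+ 2 * g + + 8 * g * g - h - + 8 * g * h + + 8 * h * h)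
  lemma = solve-∀

∏±-odd : ∀ {X : Set} (f : (X → ℤ) → ℤ) a → Odd (∏± _*_ f a) → Odd (f (a ⁺))
∏±-odd f a = odd-*ˡ (f (a ⁺)) (f (a ⁻))

∏±³-zip : ∀ {X R S : Set} (_∙_ : R → R → R) (_∘_ : S → S → S) (f : (X → ℤ) → R) (g : (X → ℤ) → S) a →
  ∏±³ (zip _∙_ _∘_) (λ b → f b , g b) a ≡ (∏±³ _∙_ f a , ∏±³ _∘_ g a)
∏±³-zip _∙_ _∘_ f g a = refl

ι≡1[mod8]⇒1+8 : ∀ x → ι x ≡ᴼ ι 1ℤ [mod ι (+ 8) ] → ∃[ α ] x ≡ 1ℤ + + 8 * α
ι≡1[mod8]⇒1+8 x ιx≡1 = let α , _ , ιx≡ = ≡1[mod8]⇒1+8 (ι x) ιx≡1 in α , cong O.coeff₁ ιx≡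

-- Embedding ℤ in `O` makes this the case φ = ι ∘ σ of the general congruence.
∏±³-σ≡1[mod8] : ∀ a → Odd (σ (a ⁺ ⁺ ⁺)) → ι (∏±³ _*_ σ a) ≡ᴼ ι 1ℤ [mod ι (+ 8) ]
∏±³-σ≡1[mod8] a odd = subst (_≡ᴼ ι 1ℤ [mod ι (+ 8) ]) (sym ι-∏) (mod8 (odd⇒1+2k odd))
  where
  mod8 : ∃[ k ] σ (a ⁺ ⁺ ⁺) ≡ 1ℤ + + 2 * k → ∏±³ _*ᴼ_ (ι ∘ σ) a ≡ᴼ ι 1ℤ [mod ι (+ 8) ]
  mod8 (k , σ≡) = ∏±³≡1[mod8] (ι ∘ σ) (λ b c → cong ι (σ-+ b c)) (λ b c → cong ι (σ-- b c)) (ι k) a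
    (trans (cong ι σ≡) (cong (ι 1ℤ +ᴼ_) (ι-* (+ 2) k)))

  ι-∏ : ι (∏±³ _*_ σ a) ≡ ∏±³ _*ᴼ_ (ι ∘ σ) a
  ι-∏ = ∏±³-rel {_∙_ = _*_} {_∘′_ = _*ᴼ_} (λ x y → ι x ≡ y)
    (λ {x} {_} {x′} p q → trans (ι-* x x′) (cong₂ _*ᴼ_ p q)) {f = σ} {g = ι ∘ σ} (λ _ → refl) a

-- The part of `T` that is multiplicative in all three arguments, so it can be verified one
-- character at a time.
Factors : ℤ → ℤ × O → Set
Factors D (A , β) = D ≡ A * N β × ι A ≡ᴼ β [mod λᴼ ]

Factors-* : ∀ {D p D′ p′} → Factors D p → Factors D′ p′ → Factors (D * D′) (zip _*_ _*ᴼ_ p p′)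
Factors-* {D} {A , β} {D′} {A′ , β′} (D≡ , A≡β) (D′≡ , A′≡β′) =
  trans (cong₂ _*_ D≡ D′≡) (trans (interchange A (N β) A′ (N β′)) (cong (A * A′ *_) (sym (N-*ᴼ β β′)))) ,
  subst (_≡ᴼ β *ᴼ β′ [mod λᴼ ]) (sym (ι-* A A′)) (≡[modλ]-*ᴼ {ι A} {β} {ι A′} {β′} A≡β A′≡β′)
  where
  interchange : ∀ a b c d → a * b * (c * d) ≡ a * c * (b * d)
  interchange = solve-∀

-- One unit η, chosen at the trivial character, multiplies the factors of all eight characters.
-- Norms are unchanged since η has norm 1, and residues modulo λ since η is 1 modulo λ.
determinant-factors : ∀ a → Odd (determinant C₂³×C₃ a) → ∃[ α ] ∃[ β ]
  (Factors (determinant C₂³×C₃ a) (1ℤ + + 8 * α , β) × β ≡ᴼ ι 1ℤ [mod ι (+ 8) ])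
determinant-factors a odd = assemble
  (ι≡1[mod8]⇒1+8 (∏±³ _*_ σ a) (∏±³-σ≡1[mod8] a (odd-*ˡ (σ b₀) (N (atω b₀)) odd-b₀)))
  (normalising-unit (atω b₀) (odd-*ʳ (σ b₀) (N (atω b₀)) odd-b₀))
  where
  b₀ : Fin 3 → ℤ
  b₀ = a ⁺ ⁺ ⁺

  value : (Fin 3 → ℤ) → ℤ
  value b = σ b * N (atω b)

  -- The factor of the trivial character divides the odd determinant.
  odd-b₀ : Odd (value b₀)
  odd-b₀ = ∏±-odd value (a ⁺ ⁺) (∏±-odd (∏± _*_ value) (a ⁺) (∏±-odd (∏± _*_ (∏± _*_ value)) a
    (subst Odd (determinant-C₂³×C₃ a) odd)))

  module _ η (Nη≡1 : N η ≡ 1ℤ) κ (η≡ : η ≡ ι 1ℤ +ᴼ λᴼ *ᴼ κ) where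
    φ : (Fin 3 → ℤ) → O
    φ b = η *ᴼ atω b

    factors : ∀ b → Factors (value b) (σ b , φ b)
    factors b =
      cong (σ b *_) (sym (trans (N-*ᴼ η (atω b)) (trans (cong (_* N (atω b)) Nη≡1) (*-identityˡ (N (atω b)))))) ,
      subst (λ e → ι (σ b) ≡ᴼ e *ᴼ atω b [mod λᴼ ]) (sym η≡) (≡[modλ]-unit {ι (σ b)} {atω b} κ (σ≡atω[modλ] b))

    ∏-factors : Factors (determinant C₂³×C₃ a) (∏±³ _*_ σ a , ∏±³ _*ᴼ_ φ a)
    ∏-factors = subst₂ Factors (sym (determinant-C₂³×C₃ a)) (∏±³-zip _*_ _*ᴼ_ σ φ a)
      (∏±³-rel {_∙_ = _*_} {_∘′_ = zip _*_ _*ᴼ_} Factors (λ {D} {p} {D′} {p′} → Factors-* {D} {p} {D′} {p′})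
         {f = value} {g = λ b → σ b , φ b} factors a)

    ∏φ≡1 : ∀ k → φ b₀ ≡ ι 1ℤ +ᴼ ι (+ 2) *ᴼ k → ∏±³ _*ᴼ_ φ a ≡ᴼ ι 1ℤ [mod ι (+ 8) ]
    ∏φ≡1 k = ∏±³≡1[mod8] φ
       (λ b c → trans (cong (η *ᴼ_) (atω-+ b c)) (*ᴼ-distribˡ-+ᴼ η (atω b) (atω c)))
       (λ b c → trans (cong (η *ᴼ_) (atω-- b c)) (*ᴼ-distribˡ-⊟ η (atω b) (atω c)))
       k a

  assemble : ∃[ α ] ∏±³ _*_ σ a ≡ 1ℤ + + 8 * α →
    ∃[ η ] ∃[ κ ] ∃[ k ] (N η ≡ 1ℤ × η ≡ ι 1ℤ +ᴼ λᴼ *ᴼ κ × η *ᴼ atω b₀ ≡ ι 1ℤ +ᴼ ι (+ 2) *ᴼ k) →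
    ∃[ α ] ∃[ β ] (Factors (determinant C₂³×C₃ a) (1ℤ + + 8 * α , β) × β ≡ᴼ ι 1ℤ [mod ι (+ 8) ])
  assemble (α , A≡) (η , κ , k , Nη≡1 , η≡ , total) = α , ∏±³ _*ᴼ_ (φ η Nη≡1 κ η≡) a ,
    subst (λ A → Factors (determinant C₂³×C₃ a) (A , ∏±³ _*ᴼ_ (φ η Nη≡1 κ η≡) a)) A≡ (∏-factors η Nη≡1 κ η≡) ,
    ∏φ≡1 η Nη≡1 κ η≡ k total

-- The two implications

1+8-odd : ∀ k → Odd (1ℤ + + 8 * k)
1+8-odd k (divides q 1+8k≡q*2) = 2*x≢1 (q - + 4 * k) (trans (lemma₁ q k) (trans (cong (_- + 8 * k) (sym 1+8k≡q*2)) (lemma₂ k)))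
  where
  lemma₁ : ∀ q k → + 2 * (q - + 4 * k) ≡ q * + 2 - + 8 * k
  lemma₁ = solve-∀
  lemma₂ : ∀ k → 1ℤ + + 8 * k - + 8 * k ≡ 1ℤ
  lemma₂ = solve-∀
  2*x≢1 : ∀ x → + 2 * x ≢ 1ℤ
  2*x≢1 (+ zero)        ()
  2*x≢1 +[1+ zero ]     ()
  2*x≢1 +[1+ suc n ]    ()
  2*x≢1 -[1+ n ]        ()

forward : ∀ D → Odd D → D ∈S C₂³×C₃ → D ≡ℤ 1ℤ [mod + 8 ] × T D
forward D odd (a , refl) = conclude (determinant-factors a odd)
  where
  lemma : ∀ α n → (1ℤ + + 8 * α) * (1ℤ + + 8 * n) - 1ℤ ≡ (α + n + + 8 * α * n) * + 8
  lemma = solve-∀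

  conclude : ∃[ α ] ∃[ β ] (Factors D (1ℤ + + 8 * α , β) × β ≡ᴼ ι 1ℤ [mod ι (+ 8) ]) →
    D ≡ℤ 1ℤ [mod + 8 ] × T D
  conclude (α , β , (D≡ , A≡β) , β≡1) =
    let g , h , β≡ = ≡1[mod8]⇒1+8 β β≡1
        n , N≡ = N-1+8 g h
    in divides (α + n + + 8 * α * n)
         (trans (cong (_- 1ℤ) (trans D≡ (cong (λ x → (1ℤ + + 8 * α) * x) (trans (cong N β≡) N≡)))) (lemma α n)) ,
       (1ℤ + + 8 * α , β , 1+8-odd α , D≡ , β≡1 , A≡β)

-- Since D = A N(β) and both D and N(β) are 1 modulo 8, so is A. The congruence of A and β modulo λ
-- then makes the linear system for r, s, t solvable.
backward : ∀ D → D ≡ℤ 1ℤ [mod + 8 ] × T D →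
  ∃[ r ] ∃[ s ] ∃[ t ] determinant C₂³×C₃ (specialElement r s t) ≡ D
backward D (divides d D-1≡ , A , β , _ , D≡ , β≡1 , (x +ω y , A-β≡)) =
  let g , h , β≡ = ≡1[mod8]⇒1+8 β β≡1
      n , N≡ = N-1+8 g h
  in build g h n β≡ N≡
  where
  open ≡-Reasoning

  A-expand : ∀ A n → A ≡ 1ℤ + (A * (1ℤ + + 8 * n) - 1ℤ) - + 8 * (A * n)
  A-expand = solve-∀
  A-collect : ∀ d m → 1ℤ + d * + 8 - + 8 * m ≡ 1ℤ + + 8 * (d - m)
  A-collect = solve-∀

  build : ∀ g h n → β ≡ (1ℤ + + 8 * g) +ω (+ 8 * h) → N ((1ℤ + + 8 * g) +ω (+ 8 * h)) ≡ 1ℤ + + 8 * n →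
    ∃[ r ] ∃[ s ] ∃[ t ] determinant C₂³×C₃ (specialElement r s t) ≡ D
  -- The special element must satisfy r - t = g, s - t = h and r + s + t = α. The first two give r
  -- and s, and the third becomes 3t = α - g - h = w.
  build g h n refl N≡ = g + t , h + t , t , (begin
    determinant C₂³×C₃ (specialElement (g + t) (h + t) t)
      ≡⟨ determinant-specialElement (g + t) (h + t) t ⟩
    (1ℤ + + 8 * (g + t + (h + t) + t)) * N ((1ℤ + + 8 * (g + t - t)) +ω (+ 8 * (h + t - t)))
      ≡⟨ cong₂ _*_ (cong (λ z → 1ℤ + + 8 * z) sum≡α)
           (cong₂ (λ g h → N ((1ℤ + + 8 * g) +ω (+ 8 * h))) (cancel g t) (cancel h t)) ⟩
    (1ℤ + + 8 * α) * N ((1ℤ + + 8 * g) +ω (+ 8 * h))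
      ≡⟨ cong (_* N ((1ℤ + + 8 * g) +ω (+ 8 * h))) A≡ ⟨
    A * N ((1ℤ + + 8 * g) +ω (+ 8 * h))
      ≡⟨ D≡ ⟨
    D ∎)
    where
    α w t : ℤ
    α = d - A * n
    w = α - g - h
    -- From 8w = 3y follows w = 9w - 8w = 3(3w - y), so this is the solution of 3t = w.
    t = + 3 * w - y

    cancel : ∀ a b → a + b - b ≡ a
    cancel = solve-∀

    A≡ : A ≡ 1ℤ + + 8 * α
    A≡ = begin
      A                                                   ≡⟨ A-expand A n ⟩
      1ℤ + (A * (1ℤ + + 8 * n) - 1ℤ) - + 8 * (A * n)      ≡⟨ cong (λ z → 1ℤ + (z - 1ℤ) - + 8 * (A * n)) (trans D≡ (cong (A *_) N≡)) ⟨
      1ℤ + (D - 1ℤ) - + 8 * (A * n)                       ≡⟨ cong (λ z → 1ℤ + z - + 8 * (A * n)) D-1≡ ⟩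
      1ℤ + d * + 8 - + 8 * (A * n)                        ≡⟨ A-collect d (A * n) ⟩
      1ℤ + + 8 * α                                        ∎

    -- Adding the two coefficients of A - β = λ (x + y ω) gives a multiple of 3.
    8w≡3y : + 8 * w ≡ + 3 * y
    8w≡3y = begin
      + 8 * w
        ≡⟨ lemma₁ α g h ⟩
      (1ℤ + + 8 * α - (1ℤ + + 8 * g)) + (0ℤ - + 8 * h)
        ≡⟨ cong (λ z → (z - (1ℤ + + 8 * g)) + (0ℤ - + 8 * h)) A≡ ⟨
      (A - (1ℤ + + 8 * g)) + (0ℤ - + 8 * h)
        ≡⟨ cong (λ z → O.coeff₁ z + O.coeffω z) A-β≡ ⟩
      (1ℤ * x - -1ℤ * y) + (1ℤ * y + -1ℤ * x - -1ℤ * y)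
        ≡⟨ lemma₂ x y ⟩
      + 3 * y ∎
      where
      lemma₁ : ∀ α g h → + 8 * (α - g - h) ≡ (1ℤ + + 8 * α - (1ℤ + + 8 * g)) + (0ℤ - + 8 * h)
      lemma₁ = solve-∀
      lemma₂ : ∀ x y → (1ℤ * x - -1ℤ * y) + (1ℤ * y + -1ℤ * x - -1ℤ * y) ≡ + 3 * y
      lemma₂ = solve-∀

    sum≡α : g + t + (h + t) + t ≡ α
    sum≡α = begin
      g + t + (h + t) + t                   ≡⟨ lemma₁ g h w y ⟩
      g + h + + 9 * w - + 3 * y             ≡⟨ cong (λ z → g + h + + 9 * w - z) 8w≡3y ⟨
      g + h + + 9 * w - + 8 * w             ≡⟨ lemma₂ g h α ⟩
      α                                     ∎
      where
      lemma₁ : ∀ g h w y → g + (+ 3 * w - y) + (h + (+ 3 * w - y)) + (+ 3 * w - y) ≡ g + h + + 9 * w - + 3 * y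
      lemma₁ = solve-∀
      lemma₂ : ∀ g h α → g + h + + 9 * (α - g - h) - + 8 * (α - g - h) ≡ α
      lemma₂ = solve-∀

proposition5p2 : (D : ℤ) → Odd D →
    (D ∈S C₂³×C₃ ⇔ (D ≡ℤ 1ℤ [mod + 8 ] × T D))
    × (D ∈S C₂³×C₃ →
    ∃[ r ] ∃[ s ] ∃[ t ]
    GroupRing.determinant C₂³×C₃ (specialElement r s t) ≡ D)
proposition5p2 D odd =
  mk⇔ (forward D odd) (λ d → let r , s , t , eq = backward D d in specialElement r s t , eq) ,
  (λ D∈S → backward D (forward D odd D∈S))
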